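{- Let $n=p_1p_2$, where $p_1,p_2$ are distinct primes. For $i=1,2$ let $s_i,t_i$ be positive integers with $s_it_i=p_i-1$ and let $g_i$ be a generator of $\mathbb{Z}_{p_i}^\times$. Let $d=\gcd(s_1,s_2)$. Let $e$ be an integer satisfying $$e\equiv g_1^{t_1}\pmod{p_1},\qquad e\equiv g_2^{t_2}\pmod{p_2},$$ and let $G=\langle e\rangle$ be the subgroup of $\mathbb{Z}_n^\times$ generated by $e$. Then the coset index function $f_G$ is a $(p_1p_2,\ 1+t_1+t_2+dt_1t_2,\ \{a_0,a_1,a_2\})$ zero-difference function, where $$a_0=\frac{1}{d}(s_1s_2-s_1-s_2)+1,\qquad a_1=\frac{(p_1-1)s_2}{d}-p_1+s_2,\qquad a_2=\frac{(p_2-1)s_1}{d}-p_2+s_1.$$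
   Context: For a subgroup $G$ of $\mathbb{Z}_n^\times$ and $r\in\mathbb{Z}_n$, the coset $rG=\{rg\mid g\in G\}$; these cosets partition $\mathbb{Z}_n$, forming a set $D_G$. The coset index function induced by $G$ is $f_G:\mathbb{Z}_n\to\mathbb{Z}_{|D_G|}$, $f_G(x)=h_G(C_x)$, where $C_x$ is the coset containing $x$ and $h_G:D_G\to\mathbb{Z}_{|D_G|}$ is a fixed bijection. A function $f:A\to B$ between finite abelian groups is an $(n,m,S)$ zero-difference function if $n=|A|$, $m=|f(A)|$, and for every nonzero $a\in A$, $|\{x\in A\mid f(x+a)=f(x)\}|\in S$. Here $A=(\mathbb{Z}_n,+)$. -}

module Defs where

open import Algebra.Bundles using (AbelianGroup; CommutativeRing; Group)
open import Algebra.Definitions using (Invertible)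
open import Data.Fin.Base using (Fin)
open import Data.Integer.Base as ℤ using (ℤ; +_; 0ℤ; 1ℤ)
open import Data.Integer.Divisibility.Signed using (_∣_; divides)
import Data.Integer.Properties as ℤ
open import Data.Integer.Tactic.RingSolver using (solve-∀)
open import Data.Nat.Base as ℕ using (ℕ; zero; suc; NonZero; ≢-nonZero; ≢-nonZero⁻¹)
open import Data.Nat.GCD using (gcd; gcd[m,n]≢0)
open import Data.Product.Base using (Σ; ∃; _×_; _,_; proj₁; proj₂; swap)
open import Data.Rational.Base as ℚ using (ℚ)
open import Data.Sum.Base using (inj₁)
open import Function.Bundles using (Bijection; Func)
open import Level using (Level; 0ℓ; _⊔_) renaming (suc to lsuc)
open import Relation.Binary.Bundles using (Setoid)
import Relation.Binary.Construct.On as On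
open import Relation.Binary.Definitions using (_Respects_)
open import Relation.Binary.PropositionalEquality
  using (_≡_; refl; sym; trans; cong; cong₂)
  renaming (setoid to ≡-setoid)
open import Relation.Nullary using (¬_)
open import Relation.Unary using (Pred; _∈_; _≐_)

private
  variable
    a b c ℓ p : Level

HasSize : Setoid a ℓ → ℕ → Set (a ⊔ ℓ)
HasSize S k = Bijection (≡-setoid (Fin k)) S

subsetoid : (S : Setoid a ℓ) → Pred (Setoid.Carrier S) p → Setoid (a ⊔ p) ℓ
subsetoid S P = On.setoid {B = Σ (Setoid.Carrier S) P} S proj₁

image : {A : Setoid a ℓ} {B : Setoid b p} → Func A B → Setoid _ _
image {B = B} f = subsetoid B (λ y → ∃ λ x → Setoid._≈_ B (Func.to f x) y)

record IsZeroDifference {a ℓ b p} (A : AbelianGroup a ℓ) (B : AbelianGroup b p)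
    (n m : ℕ) (S : Pred ℕ 0ℓ)
    (f : Func (AbelianGroup.setoid A) (AbelianGroup.setoid B)) : Set (a ⊔ ℓ ⊔ b ⊔ p) where
  private
    module A = AbelianGroup A
    module B = AbelianGroup B
    module f = Func f
  field
    domain-size     : HasSize A.setoid n
    codomain-finite : ∃ λ k → HasSize B.setoid k
    image-size      : HasSize (image f) m
    differences     : ∀ α → ¬ (α A.≈ A.ε) → ∃ λ k →
      HasSize (subsetoid A.setoid (λ x → f.to (x A.∙ α) B.≈ f.to x)) k × k ∈ S

record Subgroup (G : Group c ℓ) p : Set (c ⊔ ℓ ⊔ lsuc p) where
  open Group G
  field
    Member   : Pred Carrier p
    resp     : Member Respects _≈_
    ε-mem    : ε ∈ Member
    ∙-closed : ∀ {x y} → x ∈ Member → y ∈ Member → (x ∙ y) ∈ Member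
    ⁻¹-closed : ∀ {x} → x ∈ Member → (x ⁻¹) ∈ Member

module _ (G : Group c ℓ) where
  open Group G using (Carrier; _≈_; ε; _∙_; _⁻¹)

  -- Membership in the smallest subgroup containing g.
  data Generated (g : Carrier) : Pred Carrier (c ⊔ ℓ) where
    generator : g ∈ Generated g
    resp      : (Generated g) Respects _≈_
    ε-mem     : ε ∈ Generated g
    ∙-closed  : ∀ {x y} → x ∈ Generated g → y ∈ Generated g → (x ∙ y) ∈ Generated g
    ⁻¹-closed : ∀ {x} → x ∈ Generated g → (x ⁻¹) ∈ Generated g

  ⟨_⟩ : Carrier → Subgroup G (c ⊔ ℓ)
  ⟨ g ⟩ = record
    { Member = Generated g ; resp = resp ; ε-mem = ε-mem
    ; ∙-closed = ∙-closed ; ⁻¹-closed = ⁻¹-closed }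

  IsGenerator : Carrier → Set (c ⊔ ℓ)
  IsGenerator g = ∀ x → x ∈ Subgroup.Member ⟨ g ⟩

module _ (R : CommutativeRing c ℓ) where
  open CommutativeRing R renaming (refl to ≈-refl; sym to ≈-sym; trans to ≈-trans)
  open import Relation.Binary.Reasoning.Setoid setoid

  private
    Unit : Pred Carrier (c ⊔ ℓ)
    Unit = Invertible _≈_ 1# _*_

    interchange : ∀ x y u v → (x * y) * (u * v) ≈ (x * u) * (y * v)
    interchange x y u v = begin
      (x * y) * (u * v) ≈⟨ *-assoc x y (u * v) ⟩
      x * (y * (u * v)) ≈⟨ *-congˡ (*-assoc y u v) ⟨
      x * ((y * u) * v) ≈⟨ *-congˡ (*-congʳ (*-comm y u)) ⟩
      x * ((u * y) * v) ≈⟨ *-congˡ (*-assoc u y v) ⟩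
      x * (u * (y * v)) ≈⟨ *-assoc x u (y * v) ⟨
      (x * u) * (y * v) ∎

    mul-inv : ∀ {x y u v} → x * y ≈ 1# → u * v ≈ 1# → (x * u) * (y * v) ≈ 1#
    mul-inv {x} {y} {u} {v} p q = begin
      (x * u) * (y * v) ≈⟨ interchange x u y v ⟩
      (x * y) * (u * v) ≈⟨ *-cong p q ⟩
      1# * 1#           ≈⟨ *-identityˡ 1# ⟩
      1#                ∎

    inv-unique : ∀ {x y x′ y′} → x ≈ y → x′ * x ≈ 1# → y * y′ ≈ 1# → x′ ≈ y′
    inv-unique {x} {y} {x′} {y′} e p q = begin
      x′              ≈⟨ *-identityʳ x′ ⟨
      x′ * 1#         ≈⟨ *-congˡ q ⟨
      x′ * (y * y′)   ≈⟨ *-congˡ (*-congʳ e) ⟨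
      x′ * (x * y′)   ≈⟨ *-assoc x′ x y′ ⟨
      (x′ * x) * y′   ≈⟨ *-congʳ p ⟩
      1# * y′         ≈⟨ *-identityˡ y′ ⟩
      y′              ∎

  units : Group (c ⊔ ℓ) ℓ
  units = record
    { Carrier = Σ Carrier Unit
    ; _≈_     = λ u v → proj₁ u ≈ proj₁ v
    ; _∙_     = λ { (x , x′ , l , r) (y , y′ , l′ , r′) →
                    x * y , x′ * y′ , mul-inv l l′ , mul-inv r r′ }
    ; ε       = 1# , 1# , *-identityˡ 1# , *-identityˡ 1#
    ; _⁻¹     = λ { (x , x′ , inv) → x′ , x , swap inv }
    ; isGroup = record
      { isMonoid = record
        { isSemigroup = record
          { isMagma = record
            { isEquivalence = On.isEquivalence proj₁ isEquivalence
            ; ∙-cong        = *-cong }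
          ; assoc = λ u v w → *-assoc (proj₁ u) (proj₁ v) (proj₁ w) }
        ; identity = (λ u → *-identityˡ (proj₁ u)) , (λ u → *-identityʳ (proj₁ u)) }
      ; inverse = (λ { (_ , _ , l , _) → l }) , (λ { (_ , _ , _ , r) → r })
      ; ⁻¹-cong = λ { {_ , _ , l , _} {_ , _ , _ , r′} e → inv-unique e l r′ } } }

  module _ (G : Subgroup units p) where
    private module G = Subgroup G

    coset : Carrier → Pred Carrier (c ⊔ ℓ ⊔ p)
    coset r x = ∃ λ g → g ∈ G.Member × x ≈ r * proj₁ g

    Cosets : Setoid (lsuc (c ⊔ ℓ ⊔ p)) (c ⊔ ℓ ⊔ p)
    Cosets = record
      { Carrier = Σ (Pred Carrier (c ⊔ ℓ ⊔ p)) (λ C → ∃ λ r → C ≐ coset r)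
      ; _≈_     = λ C D → proj₁ C ≐ proj₁ D
      ; isEquivalence = record
        { refl  = (λ z → z) , (λ z → z)
        ; sym   = swap
        ; trans = λ { (f , g) (f′ , g′) → (λ z → f′ (f z)) , (λ z → g (g′ z)) } } }

    -- The coset containing x is x G: see ∈-cosetOf and cosetOf-unique.
    cosetOf : Carrier → Setoid.Carrier Cosets
    cosetOf x = coset x , x , (λ z → z) , (λ z → z)

    ∈-cosetOf : ∀ x → x ∈ proj₁ (cosetOf x)
    ∈-cosetOf x = Group.ε units , G.ε-mem , ≈-sym (*-identityʳ x)

    cosetOf-unique : ∀ C {x} → x ∈ proj₁ C → Setoid._≈_ Cosets C (cosetOf x)
    cosetOf-unique (C , r , C⊆rG , rG⊆C) {x} x∈C with C⊆rG x∈C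
    ... | g , g∈G , x≈rg = to , from
      where
      open Group units using (_∙_; _⁻¹)
      g′ = proj₁ (g ⁻¹)
      to : ∀ {y} → y ∈ C → y ∈ coset x
      to {y} y∈C with C⊆rG y∈C
      ... | h , h∈G , y≈rh = (g ⁻¹) ∙ h , G.∙-closed (G.⁻¹-closed g∈G) h∈G , (begin
        y                             ≈⟨ y≈rh ⟩
        r * proj₁ h                   ≈⟨ *-congˡ (*-identityˡ (proj₁ h)) ⟨
        r * (1# * proj₁ h)            ≈⟨ *-congˡ (*-congʳ (proj₂ (proj₂ (proj₂ g)))) ⟨
        r * ((proj₁ g * g′) * proj₁ h) ≈⟨ *-congˡ (*-assoc (proj₁ g) g′ (proj₁ h)) ⟩
        r * (proj₁ g * (g′ * proj₁ h)) ≈⟨ *-assoc r (proj₁ g) _ ⟨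
        (r * proj₁ g) * (g′ * proj₁ h) ≈⟨ *-congʳ x≈rg ⟨
        x * (g′ * proj₁ h)            ∎)
      from : ∀ {y} → y ∈ coset x → y ∈ C
      from {y} (h , h∈G , y≈xh) = rG⊆C (g ∙ h , G.∙-closed g∈G h∈G , (begin
        y                         ≈⟨ y≈xh ⟩
        x * proj₁ h               ≈⟨ *-congʳ x≈rg ⟩
        (r * proj₁ g) * proj₁ h   ≈⟨ *-assoc r (proj₁ g) (proj₁ h) ⟩
        r * (proj₁ g * proj₁ h)   ∎))

    cosetIndex : {B : Setoid a b} → Bijection Cosets B → Func setoid B
    cosetIndex h = record
      { to   = λ x → Bijection.to h (cosetOf x)
      ; cong = λ x≈y → Bijection.cong h
          ( (λ { (g , m , e) → g , m , ≈-trans e (*-congʳ x≈y) })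
          , (λ { (g , m , e) → g , m , ≈-trans e (*-congʳ (≈-sym x≈y)) }) ) }

infix 4 _≡_[mod_]

-- A record rather than a synonym, so that x and y can be inferred.
record _≡_[mod_] (x y : ℤ) (n : ℕ) : Set where
  constructor congruent
  field
    divisibility : + n ∣ x ℤ.- y

private
  module _ {n : ℕ} where abstract
    ≡⇒mod : ∀ {x y} → x ≡ y → x ≡ y [mod n ]
    ≡⇒mod {x} refl = congruent (divides 0ℤ (ℤ.+-inverseʳ x))

    mod-sym : ∀ {x y} → x ≡ y [mod n ] → y ≡ x [mod n ]
    mod-sym {x} {y} (congruent (divides q e)) = congruent (divides (ℤ.- q)
      (trans (lem x y) (trans (cong ℤ.-_ e) (ℤ.neg-distribˡ-* q (+ n)))))
      where
      lem : ∀ x y → y ℤ.- x ≡ ℤ.- (x ℤ.- y)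
      lem = solve-∀

    mod-trans : ∀ {x y z} → x ≡ y [mod n ] → y ≡ z [mod n ] → x ≡ z [mod n ]
    mod-trans {x} {y} {z} (congruent (divides q e)) (congruent (divides r e′)) =
      congruent (divides (q ℤ.+ r) (trans (lem x y z)
        (trans (cong₂ ℤ._+_ e e′) (sym (ℤ.*-distribʳ-+ (+ n) q r)))))
      where
      lem : ∀ x y z → x ℤ.- z ≡ (x ℤ.- y) ℤ.+ (y ℤ.- z)
      lem = solve-∀

    mod-+ : ∀ {x y u v} → x ≡ y [mod n ] → u ≡ v [mod n ] → x ℤ.+ u ≡ y ℤ.+ v [mod n ]
    mod-+ {x} {y} {u} {v} (congruent (divides q e)) (congruent (divides r e′)) =
      congruent (divides (q ℤ.+ r) (trans (lem x y u v)
        (trans (cong₂ ℤ._+_ e e′) (sym (ℤ.*-distribʳ-+ (+ n) q r)))))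
      where
      lem : ∀ x y u v → (x ℤ.+ u) ℤ.- (y ℤ.+ v) ≡ (x ℤ.- y) ℤ.+ (u ℤ.- v)
      lem = solve-∀

    mod-* : ∀ {x y u v} → x ≡ y [mod n ] → u ≡ v [mod n ] → x ℤ.* u ≡ y ℤ.* v [mod n ]
    mod-* {x} {y} {u} {v} (congruent (divides q e)) (congruent (divides r e′)) =
      congruent (divides (q ℤ.* u ℤ.+ y ℤ.* r) (trans (lem x y u v)
        (trans (cong₂ (λ s t → s ℤ.* u ℤ.+ y ℤ.* t) e e′) (lem′ q u y r (+ n)))))
      where
      lem : ∀ x y u v → x ℤ.* u ℤ.- y ℤ.* v ≡ (x ℤ.- y) ℤ.* u ℤ.+ y ℤ.* (u ℤ.- v)
      lem = solve-∀
      lem′ : ∀ q u y r n → (q ℤ.* n) ℤ.* u ℤ.+ y ℤ.* (r ℤ.* n) ≡ (q ℤ.* u ℤ.+ y ℤ.* r) ℤ.* n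
      lem′ = solve-∀

    mod-neg : ∀ {x y} → x ≡ y [mod n ] → ℤ.- x ≡ ℤ.- y [mod n ]
    mod-neg {x} {y} (congruent (divides q e)) = congruent (divides (ℤ.- q)
      (trans (lem x y) (trans (cong ℤ.-_ e) (ℤ.neg-distribˡ-* q (+ n)))))
      where
      lem : ∀ x y → ℤ.- x ℤ.- ℤ.- y ≡ ℤ.- (x ℤ.- y)
      lem = solve-∀

-- ℤ/nℤ as the integers with congruence modulo n for equality.
ℤ/_ : ℕ → CommutativeRing 0ℓ 0ℓ
ℤ/ n = record
  { Carrier = ℤ
  ; _≈_ = λ x y → x ≡ y [mod n ]
  ; _+_ = ℤ._+_ ; _*_ = ℤ._*_ ; -_ = ℤ.-_ ; 0# = 0ℤ ; 1# = 1ℤ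
  ; isCommutativeRing = record
    { isRing = record
      { +-isAbelianGroup = record
        { isGroup = record
          { isMonoid = record
            { isSemigroup = record
              { isMagma = record
                { isEquivalence = record
                  { refl = ≡⇒mod refl ; sym = mod-sym ; trans = mod-trans }
                ; ∙-cong = mod-+ }
              ; assoc = λ x y z → ≡⇒mod (ℤ.+-assoc x y z) }
            ; identity = (λ x → ≡⇒mod (ℤ.+-identityˡ x)) , (λ x → ≡⇒mod (ℤ.+-identityʳ x)) }
          ; inverse = (λ x → ≡⇒mod (ℤ.+-inverseˡ x)) , (λ x → ≡⇒mod (ℤ.+-inverseʳ x))
          ; ⁻¹-cong = mod-neg }
        ; comm = λ x y → ≡⇒mod (ℤ.+-comm x y) }
      ; *-cong = mod-*
      ; *-assoc = λ x y z → ≡⇒mod (ℤ.*-assoc x y z)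
      ; *-identity = (λ x → ≡⇒mod (ℤ.*-identityˡ x)) , (λ x → ≡⇒mod (ℤ.*-identityʳ x))
      ; distrib = (λ x y z → ≡⇒mod (ℤ.*-distribˡ-+ x y z)) , (λ x y z → ≡⇒mod (ℤ.*-distribʳ-+ x y z)) }
    ; *-comm = λ x y → ≡⇒mod (ℤ.*-comm x y) } }

-- An integer that is congruent to units modulo m and modulo n is a unit modulo
-- m n: if e y ≡ 1 (mod m) and e z ≡ 1 (mod n), then y + z - e y z is an inverse.
unitModProduct : ∀ {m n} (g : Group.Carrier (units (ℤ/ m))) (h : Group.Carrier (units (ℤ/ n))) (s t : ℕ)
  (e : ℤ) → e ≡ proj₁ g ℤ.^ s [mod m ] → e ≡ proj₁ h ℤ.^ t [mod n ] →
  Group.Carrier (units (ℤ/ (m ℕ.* n)))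
unitModProduct {m} {n} g h s t e e≡g^s e≡h^t =
  e , w , mod-trans (≡⇒mod (ℤ.*-comm w e)) ew≡1 , ew≡1
  where
  power-inverse : ∀ {k} (u : Group.Carrier (units (ℤ/ k))) (r : ℕ) →
    ∃ λ y → proj₁ u ℤ.^ r ℤ.* y ≡ 1ℤ [mod k ]
  power-inverse u zero = 1ℤ , ≡⇒mod refl
  power-inverse u@(x , x′ , _ , xx′≡1) (suc r) with power-inverse u r
  ... | y , q = x′ ℤ.* y , mod-trans (≡⇒mod (lem x (x ℤ.^ r) x′ y)) (mod-* xx′≡1 q)
    where
    lem : ∀ a b c d → (a ℤ.* b) ℤ.* (c ℤ.* d) ≡ (a ℤ.* c) ℤ.* (b ℤ.* d)
    lem = solve-∀

  y z w : ℤ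
  y = proj₁ (power-inverse g s)
  z = proj₁ (power-inverse h t)
  w = y ℤ.+ z ℤ.- e ℤ.* y ℤ.* z

  ey≡1 : e ℤ.* y ≡ 1ℤ [mod m ]
  ey≡1 = mod-trans (mod-* e≡g^s (≡⇒mod refl)) (proj₂ (power-inverse g s))

  ez≡1 : e ℤ.* z ≡ 1ℤ [mod n ]
  ez≡1 = mod-trans (mod-* e≡h^t (≡⇒mod refl)) (proj₂ (power-inverse h t))

  combine : e ℤ.* y ≡ 1ℤ [mod m ] → e ℤ.* z ≡ 1ℤ [mod n ] → e ℤ.* w ≡ 1ℤ [mod m ℕ.* n ]
  combine (congruent (divides q p)) (congruent (divides r p′)) =
    congruent (divides (ℤ.- (q ℤ.* r))
      (trans (lem e y z) (trans (cong₂ (λ i j → ℤ.- (i ℤ.* j)) p p′)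
        (trans (lem′ q r (+ m) (+ n)) (cong (ℤ.- (q ℤ.* r) ℤ.*_) (sym (ℤ.pos-* m n)))))))
    where
    lem : ∀ e y z → e ℤ.* (y ℤ.+ z ℤ.- e ℤ.* y ℤ.* z) ℤ.- 1ℤ
                  ≡ ℤ.- ((e ℤ.* y ℤ.- 1ℤ) ℤ.* (e ℤ.* z ℤ.- 1ℤ))
    lem = solve-∀
    lem′ : ∀ q r m n → ℤ.- ((q ℤ.* m) ℤ.* (r ℤ.* n)) ≡ ℤ.- (q ℤ.* r) ℤ.* (m ℤ.* n)
    lem′ = solve-∀

  ew≡1 : e ℤ.* w ≡ 1ℤ [mod m ℕ.* n ]
  ew≡1 = combine ey≡1 ez≡1

-- Used for the rational number 1/d.
instance
  gcd-nonZero : ∀ {m n} .{{_ : NonZero m}} → NonZero (gcd m n)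
  gcd-nonZero {m} {n} = ≢-nonZero (gcd[m,n]≢0 m n (inj₁ (≢-nonZero⁻¹ m)))

fromℕ : ℕ → ℚ
fromℕ k = + k ℚ./ 1

{-# OPTIONS --safe #-}
module Submission where

open import Defs
open import Algebra.Bundles using (CommutativeRing; Group)
open import Data.Fin.Base as Fin using (Fin; toℕ; fromℕ<)
import Data.Fin.Properties as Fin
open import Data.Integer.Base as ℤ using (ℤ; +_; 0ℤ; 1ℤ; _^_)
open import Data.Integer.DivMod using (_%ℕ_; _/ℕ_; n%ℕd<d; a≡a%ℕn+[a/ℕn]*n)
open import Data.Integer.Divisibility.Signed as ℤ∣ using (divides)
import Data.Integer.Properties as ℤ
open import Data.Integer.Tactic.RingSolver using (solve-∀)
open import Data.Nat.Base as ℕ using (ℕ; zero; suc; NonZero; _+_; _*_; _∸_; _≤_; _<_; s≤s)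
open import Data.Nat.Coprimality using (coprime⇒gcd≡1; prime⇒coprime)
open import Data.Nat.Divisibility as ℕ∣ using (_∣_)
import Data.Nat.DivMod as ℕ
open import Data.Nat.GCD using (gcd; gcd-comm; gcd-GCD; gcd[m,n]∣m; gcd[m,n]∣n; module Bézout)
open import Data.Nat.Primality using (Prime; ¬prime[0]; ¬prime[1]; prime⇒irreducible; prime⇒nonZero)
import Data.Nat.Properties as ℕ
import Data.Nat.Tactic.RingSolver as ℕ-Solver
open import Data.Product.Base using (Σ; ∃; ∃₂; _×_; _,_; proj₁; proj₂)
open import Data.Product.Function.NonDependent.Propositional using (_×-↔_)
open import Data.Rational.Base as ℚ using (1ℚ)
import Data.Rational.Properties as ℚ
open import Data.Rational.Solver using (module +-*-Solver)
open import Data.Rational.Unnormalised.Base as ℚᵘ using (mkℚᵘ; *≡*)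
import Data.Rational.Unnormalised.Properties as ℚᵘ
open import Data.Sum.Base using (_⊎_; inj₁; inj₂)
open import Data.Sum.Function.Propositional using (_⊎-↔_)
open import Function.Base using (_∘_)
open import Function.Bundles using (Bijection; Func; Inverse; _↔_)
import Function.Construct.Composition as Composition
open Composition using (_↔-∘_)
open import Function.Construct.Identity using (↔-id)
open import Level using (0ℓ)
open import Relation.Binary.Bundles using (Setoid)
open import Relation.Binary.PropositionalEquality
  using (_≡_; _≢_; refl; sym; trans; cong; cong₂; subst; subst₂; module ≡-Reasoning)
import Relation.Binary.Reasoning.Setoid as SetoidReasoning
open import Relation.Nullary using (¬_; Dec; yes; no; contradiction)
open import Relation.Nullary.Decidable using (map′)
open import Relation.Unary using (Pred; ｛_｝; _∪_; _⊢_; _≐_)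

-- For x and a, f(x + a) = f(x) says that x + a = x ω, i.e. x (ω - 1) = a, for
-- some ω in G.  Discrete logarithms with respect to g₁ and g₂ turn G into the
-- set of pairs (g₁^(k t₁), g₂^(k t₂)), so that pairs of exponents modulo s₁ and
-- s₂ come from G exactly if they agree modulo d.  If a is a unit, then ω ≠ 1
-- modulo both primes and ω determines x.  If only p₂ divides a, then modulo p₁
-- again x = a / (ω - 1), while modulo p₂ either x = 0, with s₁ - 1 choices of ω
-- modulo p₁, or x ≠ 0 is arbitrary and ω = 1 modulo p₂, which leaves s₁/d - 1
-- choices of ω modulo p₁.  Orbits with no zero coordinate are represented by
-- (g₁^i, g₂^j) with i < d t₁ and j < t₂.

-- Congruences

-- Every `d` has one source: as `α s₁ + β s₂ = d`, the multiples of `s₂` modulo `s₁` are the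
-- multiples of `d`. Hence the exponents with ω = 1 modulo `p₂` leave `s₁/d` values modulo `s₁`.
-- Hence also `i` matters only modulo `d t₁`: once `j` is normalised, the freedom left is to
-- multiply by powers of `e` whose exponents are multiples of `s₂`. Discrete logarithms are not
-- given. That `g` generates is known only as membership in an inductive closure under products and
-- inverses, so its order `p - 1` has to be extracted by counting. Subtraction and division by `d`
-- do not fit counting either. The sizes come from index sets built from sums and products, satisfy
-- identities over the naturals cleared of both, and pass to the rationals last.

module ≈-Reasoning (n : ℕ) = SetoidReasoning (CommutativeRing.setoid (ℤ/ n))

private
  variable
    m n : ℕ
    x y z : ℤ

module _ {n : ℕ} where
  private module R = CommutativeRing (ℤ/ n)

  opaque
    ≡⇒≈ : x ≡ y → x ≡ y [mod n ]
    ≡⇒≈ = R.reflexive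

    ≈-refl : x ≡ x [mod n ]
    ≈-refl = R.refl

    ≈-sym : x ≡ y [mod n ] → y ≡ x [mod n ]
    ≈-sym = R.sym

    ≈-trans : x ≡ y [mod n ] → y ≡ z [mod n ] → x ≡ z [mod n ]
    ≈-trans = R.trans

    +-mod : ∀ {u v} → x ≡ y [mod n ] → u ≡ v [mod n ] → x ℤ.+ u ≡ y ℤ.+ v [mod n ]
    +-mod = R.+-cong

    *-mod : ∀ {u v} → x ≡ y [mod n ] → u ≡ v [mod n ] → x ℤ.* u ≡ y ℤ.* v [mod n ]
    *-mod = R.*-cong

    *-modˡ : ∀ x {u v} → u ≡ v [mod n ] → x ℤ.* u ≡ x ℤ.* v [mod n ]
    *-modˡ x e = *-mod (≈-refl {x}) e

    *-modʳ : ∀ x {u v} → u ≡ v [mod n ] → u ℤ.* x ≡ v ℤ.* x [mod n ]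
    *-modʳ x e = *-mod e (≈-refl {x})

≈⇒-≈0 : x ≡ y [mod n ] → x ℤ.- y ≡ 0ℤ [mod n ]
≈⇒-≈0 {x} {y} x≈y = ≈-trans (+-mod x≈y ≈-refl) (≡⇒≈ (ℤ.+-inverseʳ y))

-≈0⇒≈ : x ℤ.- y ≡ 0ℤ [mod n ] → x ≡ y [mod n ]
-≈0⇒≈ {x} {y} e = ≈-trans (≡⇒≈ (lem x y)) (≈-trans (+-mod e ≈-refl) (≡⇒≈ (ℤ.+-identityˡ y)))
  where
  lem : ∀ x y → x ≡ x ℤ.- y ℤ.+ y
  lem = solve-∀

≡+*⇒≈ : ∀ x y q → x ≡ y ℤ.+ q ℤ.* + n → x ≡ y [mod n ]
≡+*⇒≈ {n} x y q e = congruent (divides q (trans (cong (ℤ._- y) e) (lem y (q ℤ.* + n))))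
  where
  lem : ∀ y z → y ℤ.+ z ℤ.- y ≡ z
  lem = solve-∀

≈⇒≡+* : x ≡ y [mod n ] → ∃ λ q → x ≡ y ℤ.+ q ℤ.* + n
≈⇒≡+* {x} {y} (congruent (divides q e)) = q , trans (lem x y) (cong (λ k → y ℤ.+ k) e)
  where
  lem : ∀ x y → x ≡ y ℤ.+ (x ℤ.- y)
  lem = solve-∀

mod-∣ : m ∣ n → x ≡ y [mod n ] → x ≡ y [mod m ]
mod-∣ m∣n (congruent n∣x-y) = congruent (ℤ∣.∣-trans (ℤ∣.∣ᵤ⇒∣ m∣n) n∣x-y)

mod-scale : ∀ k → x ≡ y [mod m ] → x ℤ.* + k ≡ y ℤ.* + k [mod m * k ]
mod-scale {x} {y} {m} k (congruent m∣x-y) = congruent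
  (subst₂ ℤ∣._∣_ (sym (ℤ.pos-* m k)) (lem x y (+ k)) (ℤ∣.*-monoˡ-∣ (+ k) m∣x-y))
  where
  lem : ∀ x y k → (x ℤ.- y) ℤ.* k ≡ x ℤ.* k ℤ.- y ℤ.* k
  lem = solve-∀

mod-unscale : ∀ k .{{_ : NonZero k}} → x ℤ.* + k ≡ y ℤ.* + k [mod m * k ] → x ≡ y [mod m ]
mod-unscale {x} {y} {m} k@(suc _) (congruent d) = congruent
  (ℤ∣.*-cancelʳ-∣ (+ k) (subst₂ ℤ∣._∣_ (ℤ.pos-* m k) (lem x y (+ k)) d))
  where
  lem : ∀ x y k → x ℤ.* k ℤ.- y ℤ.* k ≡ (x ℤ.- y) ℤ.* k
  lem = solve-∀

≈0? : ∀ n x → Dec (x ≡ 0ℤ [mod n ])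
≈0? n x = map′ (λ d → congruent (subst (+ n ℤ∣.∣_) (sym (ℤ.+-identityʳ x)) d))
               (λ { (congruent d) → subst (+ n ℤ∣.∣_) (ℤ.+-identityʳ x) d })
               (+ n ℤ∣.∣? x)

pos-identity : ∀ {d m n} x y → d + x * m ≡ y * n → + d ℤ.+ + x ℤ.* + m ≡ + y ℤ.* + n
pos-identity {d} {m} {n} x y e =
  trans (cong (λ k → + d ℤ.+ k) (sym (ℤ.pos-* x m))) (trans (cong +_ e) (ℤ.pos-* y n))

opaque
  bézout : ∀ m n → ∃₂ λ α β → α ℤ.* + m ℤ.+ β ℤ.* + n ≡ + gcd m n
  bézout m n with Bézout.identity (gcd-GCD m n)
  ... | Bézout.+- x y e = + x , ℤ.- (+ y) ,
      trans (cong (λ k → k ℤ.+ ℤ.- (+ y) ℤ.* + n) (sym (pos-identity y x e))) (lem (+ gcd m n) (+ y) (+ n))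
    where
    lem : ∀ g y n → g ℤ.+ y ℤ.* n ℤ.+ ℤ.- y ℤ.* n ≡ g
    lem = solve-∀
  ... | Bézout.-+ x y e = ℤ.- (+ x) , + y ,
      trans (cong (λ k → ℤ.- (+ x) ℤ.* + m ℤ.+ k) (sym (pos-identity x y e))) (lem (+ gcd m n) (+ x) (+ m))
    where
    lem : ∀ g x m → ℤ.- x ℤ.* m ℤ.+ (g ℤ.+ x ℤ.* m) ≡ g
    lem = solve-∀

-- With `α m + β n = 1`, the number `α m` is 0 modulo `m` and 1 modulo `n`, so adding `(y - x) α m`
-- to `x` changes it to `y` modulo `n` only.
chinese-remainder : gcd m n ≡ 1 → ∀ x y → ∃ λ z → z ≡ x [mod m ] × z ≡ y [mod n ]
chinese-remainder {m} {n} gcd≡1 x y with bézout m n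
... | α , β , e =
  x ℤ.+ (y ℤ.- x) ℤ.* (α ℤ.* + m) ,
  ≡+*⇒≈ _ _ ((y ℤ.- x) ℤ.* α) (cong (λ k → x ℤ.+ k) (sym (ℤ.*-assoc (y ℤ.- x) α (+ m)))) ,
  ≡+*⇒≈ _ _ (ℤ.- ((y ℤ.- x) ℤ.* β)) (trans
    (lem x y (α ℤ.* + m) (β ℤ.* + n))
    (trans (cong (λ i → x ℤ.+ (y ℤ.- x) ℤ.* i ℤ.- (y ℤ.- x) ℤ.* (β ℤ.* + n)) (trans e (cong +_ gcd≡1)))
      (lem′ x y β (+ n))))
  where
  lem : ∀ x y a b → x ℤ.+ (y ℤ.- x) ℤ.* a ≡ x ℤ.+ (y ℤ.- x) ℤ.* (a ℤ.+ b) ℤ.- (y ℤ.- x) ℤ.* b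
  lem = solve-∀
  lem′ : ∀ x y β n → x ℤ.+ (y ℤ.- x) ℤ.* 1ℤ ℤ.- (y ℤ.- x) ℤ.* (β ℤ.* n) ≡ y ℤ.+ ℤ.- ((y ℤ.- x) ℤ.* β) ℤ.* n
  lem′ = solve-∀

-- Multiply `x - y` by `1 = α m + β n`: divisibility by `n` serves the first term and divisibility
-- by `m` the second, so both become multiples of `m n`.
mod-combine : gcd m n ≡ 1 → x ≡ y [mod m ] → x ≡ y [mod n ] → x ≡ y [mod m * n ]
mod-combine {m} {n} {x} {y} gcd≡1 (congruent (divides q e)) (congruent (divides r e′)) with bézout m n
... | α , β , b = congruent (divides (r ℤ.* α ℤ.+ q ℤ.* β) (begin
  x ℤ.- y                                                       ≡⟨ ℤ.*-identityʳ (x ℤ.- y) ⟨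
  (x ℤ.- y) ℤ.* 1ℤ                                              ≡⟨ cong (λ k → (x ℤ.- y) ℤ.* + k) gcd≡1 ⟨
  (x ℤ.- y) ℤ.* + gcd m n                                       ≡⟨ cong ((x ℤ.- y) ℤ.*_) b ⟨
  (x ℤ.- y) ℤ.* (α ℤ.* + m ℤ.+ β ℤ.* + n)                       ≡⟨ ℤ.*-distribˡ-+ (x ℤ.- y) _ _ ⟩
  (x ℤ.- y) ℤ.* (α ℤ.* + m) ℤ.+ (x ℤ.- y) ℤ.* (β ℤ.* + n)       ≡⟨ cong₂ (λ u v → u ℤ.* (α ℤ.* + m) ℤ.+ v ℤ.* (β ℤ.* + n)) e′ e ⟩
  r ℤ.* + n ℤ.* (α ℤ.* + m) ℤ.+ q ℤ.* + m ℤ.* (β ℤ.* + n)       ≡⟨ lem r α q β (+ m) (+ n) ⟩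
  (r ℤ.* α ℤ.+ q ℤ.* β) ℤ.* (+ m ℤ.* + n)                       ≡⟨ cong ((r ℤ.* α ℤ.+ q ℤ.* β) ℤ.*_) (ℤ.pos-* m n) ⟨
  (r ℤ.* α ℤ.+ q ℤ.* β) ℤ.* + (m * n)                           ∎))
  where
  open ≡-Reasoning
  lem : ∀ r α q β m n → r ℤ.* n ℤ.* (α ℤ.* m) ℤ.+ q ℤ.* m ℤ.* (β ℤ.* n) ≡ (r ℤ.* α ℤ.+ q ℤ.* β) ℤ.* (m ℤ.* n)
  lem = solve-∀

-- `n` divides the distance of `a` and `b`, which is at most the larger of the two and so below `n`.
<-mod-injective : ∀ {a b} → a < n → b < n → + a ≡ + b [mod n ] → a ≡ b
<-mod-injective {n} {a} {b} a<n b<n (congruent n∣a-b) with ℤ.∣ + a ℤ.- + b ∣ in eq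
... | zero  = ℤ.+-injective (ℤ.i-j≡0⇒i≡j (+ a) (+ b) (ℤ.∣i∣≡0⇒i≡0 eq))
... | suc k = contradiction (ℕ∣.∣⇒≤ (subst (n ∣_) eq (ℤ∣.∣⇒∣ᵤ n∣a-b))) (ℕ.<⇒≱ (begin-strict
  suc k                ≡⟨ eq ⟨
  ℤ.∣ + a ℤ.- + b ∣    ≡⟨ cong ℤ.∣_∣ (ℤ.m-n≡m⊖n a b) ⟩
  ℤ.∣ a ℤ.⊖ b ∣        ≤⟨ ℤ.∣m⊝n∣≤m⊔n a b ⟩
  a ℕ.⊔ b              <⟨ ℕ.⊔-lub a<n b<n ⟩
  n                    ∎))
  where open ℕ.≤-Reasoning

toℕ-mod-injective : ∀ {i j : Fin n} → + toℕ i ≡ + toℕ j [mod n ] → i ≡ j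
toℕ-mod-injective {i = i} {j} e = Fin.toℕ-injective (<-mod-injective (Fin.toℕ<n i) (Fin.toℕ<n j) e)

opaque
  residue : ∀ n .{{_ : NonZero n}} x → ∃ λ (i : Fin n) → x ≡ + toℕ i [mod n ]
  residue n x = fromℕ< (n%ℕd<d x n) , ≡+*⇒≈ _ _ (x /ℕ n)
    (subst (λ r → x ≡ + r ℤ.+ x /ℕ n ℤ.* + n) (sym (Fin.toℕ-fromℕ< (n%ℕd<d x n))) (a≡a%ℕn+[a/ℕn]*n x n))

  nonzero-residue : ∀ n → ¬ (x ≡ 0ℤ [mod suc n ]) → ∃ λ (i : Fin n) → x ≡ + suc (toℕ i) [mod suc n ]
  nonzero-residue {x} n x≉0 with residue (suc n) x
  ... | Fin.zero  , x≈0 = contradiction x≈0 x≉0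
  ... | Fin.suc i , x≈i = i , x≈i

suc-mod-injective : ∀ {i j : Fin n} → + suc (toℕ i) ≡ + suc (toℕ j) [mod suc n ] → i ≡ j
suc-mod-injective e = Fin.suc-injective (toℕ-mod-injective e)

suc≉0 : ∀ (i : Fin n) → ¬ (+ suc (toℕ i) ≡ 0ℤ [mod suc n ])
suc≉0 i e with () ← toℕ-mod-injective {i = Fin.suc i} {j = Fin.zero} e

-- Primitive roots

opaque
  -- Opaque, as the search is too expensive to evaluate.
  pigeonhole : m < n → (f : Fin n → Fin m) → ∃₂ λ i j → i Fin.< j × f i ≡ f j
  pigeonhole = Fin.pigeonhole

-- A homomorphism exp : ℤ → (ℤ/p)ˣ with kernel mℤ and with all nonzero residues
-- as values: for p prime and m = p - 1, the powers of a primitive root.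
record Exponential (p m : ℕ) : Set where
  field
    exp           : ℤ → ℤ
    exp-cong      : ∀ {i j} → i ≡ j [mod m ] → exp i ≡ exp j [mod p ]
    exp-injective : ∀ {i j} → exp i ≡ exp j [mod p ] → i ≡ j [mod m ]
    exp-0         : exp 0ℤ ≡ 1ℤ [mod p ]
    exp-+         : ∀ i j → exp (i ℤ.+ j) ≡ exp i ℤ.* exp j [mod p ]
    exp≉0         : ∀ i → ¬ (exp i ≡ 0ℤ [mod p ])
    log           : ∀ {x} → ¬ (x ≡ 0ℤ [mod p ]) → ∃ λ i → x ≡ exp i [mod p ]

  open ≈-Reasoning p

  exp-cong-≡ : ∀ {i j} → i ≡ j → exp i ≡ exp j [mod p ]
  exp-cong-≡ refl = ≈-refl

  exp-inverse : ∀ i → exp i ℤ.* exp (ℤ.- i) ≡ 1ℤ [mod p ]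
  exp-inverse i = begin
    exp i ℤ.* exp (ℤ.- i) ≈⟨ exp-+ i (ℤ.- i) ⟨
    exp (i ℤ.- i)         ≈⟨ exp-cong-≡ (ℤ.+-inverseʳ i) ⟩
    exp 0ℤ                ≈⟨ exp-0 ⟩
    1ℤ                    ∎

  -- A nonzero `z` is `exp i` for its logarithm `i`, hence inverted by `exp (- i)`.
  *-cancelʳ : ∀ {x y z} → ¬ (z ≡ 0ℤ [mod p ]) → x ℤ.* z ≡ y ℤ.* z [mod p ] → x ≡ y [mod p ]
  *-cancelʳ {x} {y} {z} z≉0 e with log z≉0
  ... | i , z≈ = begin
    x                                  ≈⟨ unit x ⟨
    x ℤ.* z ℤ.* exp (ℤ.- i)            ≈⟨ *-modʳ (exp (ℤ.- i)) e ⟩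
    y ℤ.* z ℤ.* exp (ℤ.- i)            ≈⟨ unit y ⟩
    y                                  ∎
    where
    unit : ∀ x → x ℤ.* z ℤ.* exp (ℤ.- i) ≡ x [mod p ]
    unit x = begin
      x ℤ.* z ℤ.* exp (ℤ.- i)            ≈⟨ ≡⇒≈ (ℤ.*-assoc x z _) ⟩
      x ℤ.* (z ℤ.* exp (ℤ.- i))          ≈⟨ *-modˡ x (*-modʳ (exp (ℤ.- i)) z≈) ⟩
      x ℤ.* (exp i ℤ.* exp (ℤ.- i))      ≈⟨ *-modˡ x (exp-inverse i) ⟩
      x ℤ.* 1ℤ                           ≈⟨ ≡⇒≈ (ℤ.*-identityʳ x) ⟩
      x                                  ∎

  *-cancelˡ : ∀ {x y z} → ¬ (z ≡ 0ℤ [mod p ]) → z ℤ.* x ≡ z ℤ.* y [mod p ] → x ≡ y [mod p ]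
  *-cancelˡ {x} {y} {z} z≉0 e =
    *-cancelʳ z≉0 (≈-trans (≡⇒≈ (ℤ.*-comm x z)) (≈-trans e (≡⇒≈ (ℤ.*-comm z y))))

  divide : ∀ a {y} → ¬ (y ≡ 0ℤ [mod p ]) → ∃ λ x → x ℤ.* y ≡ a [mod p ]
  divide a {y} y≉0 with log y≉0
  ... | i , y≈ = a ℤ.* exp (ℤ.- i) , (begin
    a ℤ.* exp (ℤ.- i) ℤ.* y        ≈⟨ *-modˡ (a ℤ.* exp (ℤ.- i)) y≈ ⟩
    a ℤ.* exp (ℤ.- i) ℤ.* exp i    ≈⟨ ≡⇒≈ (lem a (exp i) (exp (ℤ.- i))) ⟩
    a ℤ.* (exp i ℤ.* exp (ℤ.- i))  ≈⟨ *-modˡ a (exp-inverse i) ⟩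
    a ℤ.* 1ℤ                       ≈⟨ ≡⇒≈ (ℤ.*-identityʳ a) ⟩
    a                              ∎)
    where
    lem : ∀ a b c → a ℤ.* c ℤ.* b ≡ a ℤ.* (b ℤ.* c)
    lem = solve-∀

module PrimitiveRoot (m : ℕ) .{{_ : NonZero m}} (pr : Prime (suc m))
  (u : Group.Carrier (units (ℤ/ suc m))) (gen : IsGenerator (units (ℤ/ suc m)) u) where
  private
    p   = suc m
    g   = proj₁ u
    g⁻¹ = proj₁ (proj₂ u)
    g⁻¹g≈1 = proj₁ (proj₂ (proj₂ u))

  open ≈-Reasoning p

  residue≈ : ∀ i → i ≡ + (i %ℕ m) [mod m ]
  residue≈ i = ≡+*⇒≈ _ _ (i /ℕ m) (a≡a%ℕn+[a/ℕn]*n i m)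

  cancel-^ : ∀ k {x y} → g ^ k ℤ.* x ≡ g ^ k ℤ.* y [mod p ] → x ≡ y [mod p ]
  cancel-^ zero {x} {y} e = ≈-trans (≡⇒≈ (sym (ℤ.*-identityˡ x))) (≈-trans e (≡⇒≈ (ℤ.*-identityˡ y)))
  cancel-^ (suc k) {x} {y} e = cancel-^ k (begin
    g ^ k ℤ.* x                        ≈⟨ step x ⟨
    g⁻¹ ℤ.* (g ^ suc k ℤ.* x)          ≈⟨ *-modˡ g⁻¹ e ⟩
    g⁻¹ ℤ.* (g ^ suc k ℤ.* y)          ≈⟨ step y ⟩
    g ^ k ℤ.* y                        ∎)
    where
    lem : ∀ i g h x → i ℤ.* (g ℤ.* h ℤ.* x) ≡ i ℤ.* g ℤ.* (h ℤ.* x)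
    lem = solve-∀
    step : ∀ x → g⁻¹ ℤ.* (g ^ suc k ℤ.* x) ≡ g ^ k ℤ.* x [mod p ]
    step x = begin
      g⁻¹ ℤ.* (g ^ suc k ℤ.* x)     ≈⟨ ≡⇒≈ (lem g⁻¹ g (g ^ k) x) ⟩
      g⁻¹ ℤ.* g ℤ.* (g ^ k ℤ.* x)   ≈⟨ *-modʳ (g ^ k ℤ.* x) g⁻¹g≈1 ⟩
      1ℤ ℤ.* (g ^ k ℤ.* x)          ≈⟨ ≡⇒≈ (ℤ.*-identityˡ (g ^ k ℤ.* x)) ⟩
      g ^ k ℤ.* x                   ∎

  1≉0 : ¬ (1ℤ ≡ 0ℤ [mod p ])
  1≉0 e with () ← <-mod-injective (ℕ.s<s (ℕ.>-nonZero⁻¹ m)) ℕ.z<s e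

  ^≉0 : ∀ k → ¬ (g ^ k ≡ 0ℤ [mod p ])
  ^≉0 k e = 1≉0 (cancel-^ k {1ℤ} {0ℤ} (≈-trans (≡⇒≈ (ℤ.*-identityʳ (g ^ k))) (≈-trans e (≡⇒≈ (sym (ℤ.*-zeroʳ (g ^ k)))))))

  ^-period : ∀ k r → g ^ (k + r) ≡ g ^ k [mod p ] → g ^ r ≡ 1ℤ [mod p ]
  ^-period k r e = cancel-^ k (begin
    g ^ k ℤ.* g ^ r  ≈⟨ ≡⇒≈ (ℤ.^-distribˡ-+-* g k r) ⟨
    g ^ (k + r)      ≈⟨ e ⟩
    g ^ k            ≈⟨ ≡⇒≈ (ℤ.*-identityʳ (g ^ k)) ⟨
    g ^ k ℤ.* 1ℤ     ∎)

  ^-* : ∀ r q → g ^ r ≡ 1ℤ [mod p ] → g ^ (q * r) ≡ 1ℤ [mod p ]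
  ^-* r zero    e = ≈-refl
  ^-* r (suc q) e = ≈-trans (≡⇒≈ (ℤ.^-distribˡ-+-* g r (q * r))) (*-mod e (^-* r q e))

  ^-%-period : ∀ r .{{_ : NonZero r}} k → g ^ r ≡ 1ℤ [mod p ] → g ^ k ≡ g ^ (k ℕ.% r) [mod p ]
  ^-%-period r k e = begin
    g ^ k                                  ≡⟨ cong (g ^_) (ℕ.m≡m%n+[m/n]*n k r) ⟩
    g ^ (k ℕ.% r + k ℕ./ r * r)            ≡⟨ ℤ.^-distribˡ-+-* g (k ℕ.% r) _ ⟩
    g ^ (k ℕ.% r) ℤ.* g ^ (k ℕ./ r * r)    ≈⟨ *-modˡ (g ^ (k ℕ.% r)) (^-* r (k ℕ./ r) e) ⟩
    g ^ (k ℕ.% r) ℤ.* 1ℤ                   ≡⟨ ℤ.*-identityʳ (g ^ (k ℕ.% r)) ⟩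
    g ^ (k ℕ.% r)                          ∎

  -- The `m + 1` powers `g ^ 0`, ..., `g ^ m` lie among `m` nonzero residues, so two of them
  -- coincide. The form `suc r` makes `g ^ r` an inverse of `g`.
  short-period : ∃ λ r → suc r ≤ m × g ^ suc r ≡ 1ℤ [mod p ]
  short-period = period (pigeonhole (ℕ.n<1+n m) f)
    where
    f : Fin p → Fin m
    f i = proj₁ (nonzero-residue m (^≉0 (toℕ i)))

    f≈ : ∀ i → g ^ toℕ i ≡ + suc (toℕ (f i)) [mod p ]
    f≈ i = proj₂ (nonzero-residue m (^≉0 (toℕ i)))

    period : (∃₂ λ i j → i Fin.< j × f i ≡ f j) → ∃ λ r → suc r ≤ m × g ^ suc r ≡ 1ℤ [mod p ]
    period (i , j , i<j , e) = r ,
      ℕ.≤-trans (subst (suc r ≤_) j≡ (ℕ.m≤n+m (suc r) (toℕ i))) (ℕ.≤-pred (Fin.toℕ<n j)) ,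
      ^-period (toℕ i) (suc r) (begin
        g ^ (toℕ i + suc r)    ≡⟨ cong (g ^_) j≡ ⟩
        g ^ toℕ j              ≈⟨ f≈ j ⟩
        + suc (toℕ (f j))      ≡⟨ cong (λ k → + suc (toℕ k)) e ⟨
        + suc (toℕ (f i))      ≈⟨ f≈ i ⟨
        g ^ toℕ i              ∎)
      where
      r = toℕ j ∸ suc (toℕ i)
      j≡ : toℕ i + suc r ≡ toℕ j
      j≡ = trans (ℕ.+-suc (toℕ i) r) (ℕ.m+[n∸m]≡n i<j)

  -- Any period is enough to keep the exponents natural: as `k + k r` is a multiple of the period
  -- `suc r`, the inverse of `g ^ k` is `g ^ (k * r)`.
  generated⇒power : ∀ r → g ^ suc r ≡ 1ℤ [mod p ] → ∀ {v} → Generated (units (ℤ/ p)) u v → ∃ λ k → proj₁ v ≡ g ^ k [mod p ]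
  generated⇒power r g^r≈1 generator = 1 , ≡⇒≈ (sym (ℤ.^-identityʳ g))
  generated⇒power r g^r≈1 (resp v≈w v∈) with generated⇒power r g^r≈1 v∈
  ... | k , v≈ = k , ≈-trans (≈-sym v≈w) v≈
  generated⇒power r g^r≈1 ε-mem = 0 , ≈-refl
  generated⇒power r g^r≈1 (∙-closed v∈ w∈) with generated⇒power r g^r≈1 v∈ | generated⇒power r g^r≈1 w∈
  ... | k , v≈ | l , w≈ = k + l , ≈-trans (*-mod v≈ w≈) (≡⇒≈ (sym (ℤ.^-distribˡ-+-* g k l)))
  generated⇒power r g^r≈1 (⁻¹-closed {v , v′ , _ , vv′≈1} v∈) with generated⇒power r g^r≈1 v∈
  ... | k , v≈ = k * r , cancel-^ k (begin
    g ^ k ℤ.* v′             ≈⟨ *-modʳ v′ v≈ ⟨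
    v ℤ.* v′                 ≈⟨ vv′≈1 ⟩
    1ℤ                       ≈⟨ ^-* (suc r) k g^r≈1 ⟨
    g ^ (k * suc r)          ≡⟨ cong (g ^_) (ℕ.*-suc k r) ⟩
    g ^ (k + k * r)          ≡⟨ ℤ.^-distribˡ-+-* g k (k * r) ⟩
    g ^ k ℤ.* g ^ (k * r)    ∎)

  -- The generator hypothesis speaks of units with a chosen inverse, so a nonzero residue must first
  -- be packaged as one: it is coprime to the larger prime `p`, and the Bézout coefficient `α` is
  -- its inverse.
  unit : (i : Fin m) → ∃ λ (v : Group.Carrier (units (ℤ/ p))) → proj₁ v ≡ + suc (toℕ i)
  unit i with bézout (suc (toℕ i)) p
  ... | α , β , e = (+ suc (toℕ i) , α , αi≈1 , ≈-trans (≡⇒≈ (ℤ.*-comm (+ suc (toℕ i)) α)) αi≈1) , refl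
    where
    coprime : gcd p (suc (toℕ i)) ≡ 1
    coprime = coprime⇒gcd≡1 (prime⇒coprime pr (s≤s (Fin.toℕ<n i)))
    lem : ∀ x y → x ≡ x ℤ.+ y ℤ.- y
    lem = solve-∀
    lem′ : ∀ β p → 1ℤ ℤ.- β ℤ.* p ≡ 1ℤ ℤ.+ ℤ.- β ℤ.* p
    lem′ = solve-∀
    αi≈1 : α ℤ.* + suc (toℕ i) ≡ 1ℤ [mod p ]
    αi≈1 = ≡+*⇒≈ _ _ (ℤ.- β) (trans (lem _ (β ℤ.* + p))
      (trans (cong (ℤ._- β ℤ.* + p) (trans e (cong +_ (trans (gcd-comm (suc (toℕ i)) p) coprime)))) (lem′ β (+ p))))

  nat-log : (i : Fin m) → ∃ λ k → + suc (toℕ i) ≡ g ^ k [mod p ]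
  nat-log i = from-unit (unit i)
    where
    from-unit : (∃ λ (v : Group.Carrier (units (ℤ/ p))) → proj₁ v ≡ + suc (toℕ i)) → _
    from-unit (v , refl) = generated⇒power (proj₁ short-period) (proj₂ (proj₂ short-period)) (gen v)

  -- All `m` nonzero residues are powers of `g` with exponents reduced modulo `r`; if `r < m`, two
  -- different residues would share an exponent.
  period-≥ : ∀ r .{{_ : NonZero r}} → g ^ r ≡ 1ℤ [mod p ] → m ≤ r
  period-≥ r e = ℕ.≮⇒≥ λ r<m → collision (pigeonhole r<m f)
    where
    k : Fin m → ℕ
    k i = proj₁ (nat-log i)
    f : Fin m → Fin r
    f i = fromℕ< (ℕ.m%n<n (k i) r)
    g^k≈ : ∀ i → + suc (toℕ i) ≡ g ^ toℕ (f i) [mod p ]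
    g^k≈ i = begin
      + suc (toℕ i)      ≈⟨ proj₂ (nat-log i) ⟩
      g ^ k i            ≈⟨ ^-%-period r (k i) e ⟩
      g ^ (k i ℕ.% r)    ≡⟨ cong (g ^_) (Fin.toℕ-fromℕ< (ℕ.m%n<n (k i) r)) ⟨
      g ^ toℕ (f i)      ∎
    collision : ¬ ∃₂ λ i j → i Fin.< j × f i ≡ f j
    collision (i , j , i<j , fi≡fj) = ℕ.<⇒≢ i<j (cong toℕ
      (suc-mod-injective {i = i} {j} (≈-trans (g^k≈ i) (≈-trans (≡⇒≈ (cong (λ l → g ^ toℕ l) fi≡fj)) (≈-sym (g^k≈ j))))))

  g^m≈1 : g ^ m ≡ 1ℤ [mod p ]
  g^m≈1 = period≡m short-period
    where
    period≡m : (∃ λ r → suc r ≤ m × g ^ suc r ≡ 1ℤ [mod p ]) → g ^ m ≡ 1ℤ [mod p ]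
    period≡m (r , r≤m , e) = subst (λ k → g ^ k ≡ 1ℤ [mod p ]) (ℕ.≤-antisym r≤m (period-≥ (suc r) e)) e

  order : ∀ k → g ^ k ≡ 1ℤ [mod p ] → m ∣ k
  order k e with k ℕ.% m in eq
  ... | zero  = ℕ∣.m%n≡0⇒n∣m k m eq
  -- The remainder is itself a period, positive and below `m`.
  ... | suc r = contradiction
    (period-≥ (suc r) (subst (λ l → g ^ l ≡ 1ℤ [mod p ]) eq (≈-trans (≈-sym (^-%-period m k g^m≈1)) e)))
    (ℕ.<⇒≱ (subst (_< m) eq (ℕ.m%n<n k m)))

  ^-cong : ∀ i j → + i ≡ + j [mod m ] → g ^ i ≡ g ^ j [mod p ]
  ^-cong i j e = ≈-trans (^-%-period m i g^m≈1) (≈-trans (≡⇒≈ (cong (g ^_) i%m≡j%m)) (≈-sym (^-%-period m j g^m≈1)))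
    where
    i%m≡j%m : i ℕ.% m ≡ j ℕ.% m
    i%m≡j%m = <-mod-injective (ℕ.m%n<n i m) (ℕ.m%n<n j m)
      (≈-trans (≈-sym (residue≈ (+ i))) (≈-trans e (residue≈ (+ j))))

  ^-injective-≤ : ∀ {i j} → i ≤ j → g ^ i ≡ g ^ j [mod p ] → + j ≡ + i [mod m ]
  ^-injective-≤ {i} {j} i≤j e = mod-+-∣ (ℕ.m+[n∸m]≡n i≤j) (order (j ∸ i) (^-period i (j ∸ i)
    (≈-trans (≡⇒≈ (cong (g ^_) (ℕ.m+[n∸m]≡n i≤j))) (≈-sym e))))
    where
    mod-+-∣ : ∀ {r} → i + r ≡ j → m ∣ r → + j ≡ + i [mod m ]
    mod-+-∣ refl (ℕ∣.divides q refl) =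
      ≡+*⇒≈ _ _ (+ q) (trans (ℤ.pos-+ i (q * m)) (cong (λ k → + i ℤ.+ k) (ℤ.pos-* q m)))

  ^-injective : ∀ i j → g ^ i ≡ g ^ j [mod p ] → + i ≡ + j [mod m ]
  ^-injective i j e with ℕ.≤-total i j
  ... | inj₁ i≤j = ≈-sym (^-injective-≤ i≤j e)
  ... | inj₂ j≤i = ^-injective-≤ j≤i (≈-sym e)

  -- Reducing modulo `m` first gives negative exponents a meaning, although `_^_` takes natural
  -- exponents.
  exp : ℤ → ℤ
  exp i = g ^ (i %ℕ m)

  exp-cong : ∀ {i j} → i ≡ j [mod m ] → exp i ≡ exp j [mod p ]
  exp-cong {i} {j} e = ^-cong (i %ℕ m) (j %ℕ m) (≈-trans (≈-sym (residue≈ i)) (≈-trans e (residue≈ j)))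

  log : ∀ {x} → ¬ (x ≡ 0ℤ [mod p ]) → ∃ λ i → x ≡ exp i [mod p ]
  log {x} x≉0 with nonzero-residue m x≉0
  ... | i , x≈i = + k , ≈-trans x≈i (≈-trans (proj₂ (nat-log i)) (^-cong k (+ k %ℕ m) (residue≈ (+ k))))
    where k = proj₁ (nat-log i)

  exponential-suc : Exponential p m
  exponential-suc = record
    { exp           = exp
    ; exp-cong      = exp-cong
    ; exp-injective = λ {i} {j} e → ≈-trans (residue≈ i) (≈-trans (^-injective (i %ℕ m) (j %ℕ m) e) (≈-sym (residue≈ j)))
    ; exp-0         = ≡⇒≈ (cong (g ^_) (ℕ.m<n⇒m%n≡m (ℕ.>-nonZero⁻¹ m)))
    ; exp-+         = λ i j → ≈-trans
    (^-cong ((i ℤ.+ j) %ℕ m) (i %ℕ m + j %ℕ m)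
    (≈-trans (≈-sym (residue≈ (i ℤ.+ j))) (≈-trans (+-mod (residue≈ i) (residue≈ j)) (≡⇒≈ (sym (ℤ.pos-+ (i %ℕ m) (j %ℕ m)))))))
    (≡⇒≈ (ℤ.^-distribˡ-+-* g (i %ℕ m) (j %ℕ m)))
    ; exp≉0         = λ i → ^≉0 (i %ℕ m)
    ; log           = log
    }

  exp-^ : ∀ k → exp (+ k) ≡ g ^ k [mod p ]
  exp-^ k = ^-cong (+ k %ℕ m) k (≈-sym (residue≈ (+ k)))

-- An `Exponential` forgets its generator; the second component remembers it, so that `e` can later
-- be recognised as `pow 1ℤ` for both primes.
exponential : ∀ {p} → Prime p → (g : Group.Carrier (units (ℤ/ p))) → IsGenerator (units (ℤ/ p)) g →
  Σ (Exponential p (p ∸ 1)) λ E → ∀ k → Exponential.exp E (+ k) ≡ proj₁ g ^ k [mod p ]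
exponential {zero}        pr = contradiction pr ¬prime[0]
exponential {suc zero}    pr = contradiction pr ¬prime[1]
exponential {suc (suc m)} pr g gen = exponential-suc , exp-^
  where open PrimitiveRoot (suc m) pr g gen

-- Counting by parametrisation, and splitting modulo two coprime factors

enumerate : ∀ {a ℓ ℓ′} {I : Set} {k : ℕ} {S : Setoid a ℓ} {P : Pred (Setoid.Carrier S) ℓ′} (let open Setoid S) →
  Fin k ↔ I → (f : I → Carrier) → (∀ i → P (f i)) → (∀ i j → f i ≈ f j → i ≡ j) →
  (∀ x → P x → ∃ λ i → f i ≈ x) → HasSize (subsetoid S P) k
enumerate {S = S} I↔ f Pf f-injective f-surjective = record
  { to        = λ i → f (to i) , Pf (to i)
  ; cong      = λ { refl → S.refl }
  ; bijective =
      (λ {i} {j} e → trans (sym (strictlyInverseʳ i)) (trans (cong from (f-injective (to i) (to j) e)) (strictlyInverseʳ j))) ,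
      (λ { (x , Px) → from (proj₁ (f-surjective x Px)) , λ { refl →
        S.trans (S.reflexive (cong f (strictlyInverseˡ _))) (proj₂ (f-surjective x Px)) } })
  }
  where
  module S = Setoid S
  open Inverse I↔

-- The Chinese remainder theorem for `n = p q` as an interface symmetric in `p` and `q`: via
-- `split-swap`, one count serves both the multiples of `p₁` and those of `p₂`.
record Split (n p q : ℕ) : Set where
  field
    toˡ  : x ≡ y [mod n ] → x ≡ y [mod p ]
    toʳ  : x ≡ y [mod n ] → x ≡ y [mod q ]
    from : x ≡ y [mod p ] → x ≡ y [mod q ] → x ≡ y [mod n ]
    pair : ∀ x y → ∃ λ z → z ≡ x [mod p ] × z ≡ y [mod q ]

split-swap : ∀ {p q} → Split n p q → Split n q p
split-swap S = record
  { toˡ = S.toʳ ; toʳ = S.toˡ ; from = λ e e′ → S.from e′ e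
  ; pair = λ x y → let (z , z≈y , z≈x) = S.pair y x in z , z≈x , z≈y }
  where module S = Split S

split-* : ∀ {p q} → gcd p q ≡ 1 → Split (p * q) p q
split-* {p} {q} gcd≡1 = record
  { toˡ = mod-∣ (ℕ∣.m∣m*n q) ; toʳ = mod-∣ (ℕ∣.n∣m*n p)
  ; from = mod-combine gcd≡1 ; pair = chinese-remainder gcd≡1 }

+-cancelˡ-mod : ∀ x → x ℤ.+ y ≡ x ℤ.+ z [mod n ] → y ≡ z [mod n ]
+-cancelˡ-mod {y} {z} x e = ≈-trans (≡⇒≈ (lem x y)) (≈-trans (+-mod (≈-refl {x = ℤ.- x}) e) (≡⇒≈ (sym (lem x z))))
  where
  lem : ∀ x y → y ≡ ℤ.- x ℤ.+ (x ℤ.+ y)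
  lem = solve-∀

*0-mod : ∀ x → y ≡ 0ℤ [mod n ] → x ℤ.* y ≡ 0ℤ [mod n ]
*0-mod x e = ≈-trans (*-modˡ x e) (≡⇒≈ (ℤ.*-zeroʳ x))

0*-mod : ∀ x → y ≡ 0ℤ [mod n ] → y ℤ.* x ≡ 0ℤ [mod n ]
0*-mod x e = ≈-trans (*-modʳ x e) (≡⇒≈ (ℤ.*-zeroˡ x))

-- The subgroup of order `s` modulo `p`, and the equation `x (ω - 1) = a`

module Powers {p s t : ℕ} .{{_ : NonZero t}} (E : Exponential p (s * t)) where
  open Exponential E public

  opaque
    pow : ℤ → ℤ
    pow k = exp (k ℤ.* + t)

    pow-1 : pow 1ℤ ≡ exp (+ t) [mod p ]
    pow-1 = exp-cong-≡ (ℤ.*-identityˡ (+ t))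

    pow-cong : ∀ {i j} → i ≡ j [mod s ] → pow i ≡ pow j [mod p ]
    pow-cong i≈j = exp-cong (mod-scale t i≈j)

    pow-injective : ∀ {i j} → pow i ≡ pow j [mod p ] → i ≡ j [mod s ]
    pow-injective e = mod-unscale t (exp-injective e)

    pow-0 : pow 0ℤ ≡ 1ℤ [mod p ]
    pow-0 = exp-0

    pow-+ : ∀ i j → pow (i ℤ.+ j) ≡ pow i ℤ.* pow j [mod p ]
    pow-+ i j = ≈-trans (exp-cong-≡ (ℤ.*-distribʳ-+ (+ t) i j)) (exp-+ (i ℤ.* + t) (j ℤ.* + t))

    pow-1≉0 : ∀ {i} → ¬ (i ≡ 0ℤ [mod s ]) → ¬ (pow i ℤ.- 1ℤ ≡ 0ℤ [mod p ])
    pow-1≉0 i≉0 e = i≉0 (pow-injective (≈-trans (-≈0⇒≈ e) (≈-sym pow-0)))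

    pow≉0 : ∀ k → ¬ (pow k ≡ 0ℤ [mod p ])
    pow≉0 k = exp≉0 (k ℤ.* + t)

    pow-inverse : ∀ k {x y} → x ≡ pow k [mod p ] → x ℤ.* y ≡ 1ℤ [mod p ] → y ≡ pow (ℤ.- k) [mod p ]
    pow-inverse k {x} {y} x≈ xy≈1 = *-cancelˡ {z = pow k} (pow≉0 k) (begin
      pow k ℤ.* y             ≈⟨ *-modʳ y x≈ ⟨
      x ℤ.* y                 ≈⟨ xy≈1 ⟩
      1ℤ                      ≈⟨ pow-0 ⟨
      pow 0ℤ                  ≡⟨ cong pow (ℤ.+-inverseʳ k) ⟨
      pow (k ℤ.- k)           ≈⟨ pow-+ k (ℤ.- k) ⟩
      pow k ℤ.* pow (ℤ.- k)   ∎)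
      where open ≈-Reasoning p

    exp-*-pow : ∀ i k → exp i ℤ.* pow k ≡ exp (i ℤ.+ k ℤ.* + t) [mod p ]
    exp-*-pow i k = ≈-sym (exp-+ i (k ℤ.* + t))

    exp-*-pow-injective : ∀ i j k → exp j ≡ exp i ℤ.* pow k [mod p ] → j ≡ i ℤ.+ k ℤ.* + t [mod s * t ]
    exp-*-pow-injective i j k e = exp-injective (≈-trans e (exp-*-pow i k))

    exp-*-pow-cong : ∀ {x} j i k → x ≡ exp j [mod p ] → j ≡ i ℤ.+ k ℤ.* + t [mod s * t ] → x ≡ exp i ℤ.* pow k [mod p ]
    exp-*-pow-cong j i k x≈ j≈ = ≈-trans x≈ (≈-trans (exp-cong j≈) (≈-sym (exp-*-pow i k)))

    0≉exp*pow : ∀ i k → ¬ (0ℤ ≡ exp i ℤ.* pow k [mod p ])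
    0≉exp*pow i k e = exp≉0 (i ℤ.+ k ℤ.* + t) (≈-trans (≈-sym (exp-*-pow i k)) (≈-sym e))

    exp≉0*pow : ∀ i k → ¬ (exp i ≡ 0ℤ ℤ.* pow k [mod p ])
    exp≉0*pow i k e = exp≉0 i (≈-trans e (≡⇒≈ (ℤ.*-zeroˡ (pow k))))

    -- x + a = x ω rewritten as x (ω - 1) = a.
    Solves : ℤ → ℤ → ℤ → Set
    Solves a k x = x ℤ.* (pow k ℤ.- 1ℤ) ≡ a [mod p ]

    x+x[w-1]≡xw : ∀ x w → x ℤ.+ x ℤ.* (w ℤ.- 1ℤ) ≡ x ℤ.* w
    x+x[w-1]≡xw = solve-∀

    solves⇒shift : ∀ a k x → Solves a k x → x ℤ.+ a ≡ x ℤ.* pow k [mod p ]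
    solves⇒shift a k x e = ≈-trans (+-mod (≈-refl {x = x}) (≈-sym e)) (≡⇒≈ (x+x[w-1]≡xw x (pow k)))

    shift⇒solves : ∀ a k x → x ℤ.+ a ≡ x ℤ.* pow k [mod p ] → Solves a k x
    shift⇒solves a k x e = +-cancelˡ-mod x (≈-trans (≡⇒≈ (x+x[w-1]≡xw x (pow k))) (≈-sym e))

    solves-cong : ∀ {a k l} x y → x ≡ y [mod p ] → k ≡ l [mod s ] → Solves a k x → Solves a l y
    solves-cong {a} {k} {l} x y x≈y k≈l e = ≈-trans
      (*-mod (≈-sym x≈y) (+-mod (pow-cong (≈-sym k≈l)) (≈-refl {x = ℤ.- 1ℤ}))) e

    solves-≉0 : ∀ {a k} x → ¬ (a ≡ 0ℤ [mod p ]) → Solves a k x → ¬ (k ≡ 0ℤ [mod s ])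
    solves-≉0 {a} {k} x a≉0 e k≈0 = a≉0 (≈-trans (≈-sym e) (*0-mod x (≈⇒-≈0 (≈-trans (pow-cong k≈0) pow-0))))

    solves-unique : ∀ {a k} x y → ¬ (k ≡ 0ℤ [mod s ]) → Solves a k x → Solves a k y → x ≡ y [mod p ]
    solves-unique x y k≉0 e e′ = *-cancelʳ (pow-1≉0 k≉0) (≈-trans e (≈-sym e′))

    -- As `a` is nonzero, so is `x`, and ω is recovered from `x` as `1 + a / x`. This makes the
    -- parametrisations of solutions by exponents injective.
    solves-exponent : ∀ {a k l} x y → ¬ (a ≡ 0ℤ [mod p ]) → x ≡ y [mod p ] →
      Solves a k x → Solves a l y → k ≡ l [mod s ]
    solves-exponent {a} {k} {l} x y a≉0 x≈y e e′ = pow-injective (≈-trans (≡⇒≈ (lem (pow k)))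
      (≈-trans (+-mod (*-cancelˡ {z = x} x≉0 (≈-trans e (≈-sym (≈-trans (*-modʳ (pow l ℤ.- 1ℤ) x≈y) e′)))) (≈-refl {x = 1ℤ}))
        (≡⇒≈ (sym (lem (pow l))))))
      where
      x≉0 : ¬ (x ≡ 0ℤ [mod p ])
      x≉0 x≈0 = a≉0 (≈-trans (≈-sym e) (0*-mod (pow k ℤ.- 1ℤ) x≈0))
      lem : ∀ w → w ≡ w ℤ.- 1ℤ ℤ.+ 1ℤ
      lem = solve-∀

    solution : ∀ a {k} → ¬ (k ≡ 0ℤ [mod s ]) → ∃ λ x → Solves a k x
    solution a k≉0 = divide a (pow-1≉0 k≉0)

    -- Where `a` vanishes, one factor of `x (ω - 1)` has to vanish. This lemma and `solves-period`
    -- are the two alternatives; `solves-0⇒period` shows that there is no third.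
    solves-0 : ∀ {a k} x → a ≡ 0ℤ [mod p ] → x ≡ 0ℤ [mod p ] → Solves a k x
    solves-0 {a} {k} x a≈0 x≈0 = ≈-trans (0*-mod (pow k ℤ.- 1ℤ) x≈0) (≈-sym a≈0)

    solves-period : ∀ {a k} x → a ≡ 0ℤ [mod p ] → k ≡ 0ℤ [mod s ] → Solves a k x
    solves-period x a≈0 k≈0 = ≈-trans (*0-mod x (≈⇒-≈0 (≈-trans (pow-cong k≈0) pow-0))) (≈-sym a≈0)

    solves-0⇒period : ∀ {a k} x → a ≡ 0ℤ [mod p ] → ¬ (x ≡ 0ℤ [mod p ]) → Solves a k x → k ≡ 0ℤ [mod s ]
    solves-0⇒period x a≈0 x≉0 e = pow-injective (≈-trans (-≈0⇒≈ (*-cancelˡ {z = x} x≉0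
      (≈-trans e (≈-trans a≈0 (≡⇒≈ (sym (ℤ.*-zeroʳ x))))))) (≈-sym pow-0))

-- One exponent `k` serves both moduli: this couples the two components of an element of the cyclic
-- group.
Orbit : ∀ {p q s t s′ t′} .{{_ : NonZero t}} .{{_ : NonZero t′}} →
  Exponential p (s * t) → Exponential q (s′ * t′) → ℤ → Pred ℤ 0ℓ
Orbit {p} {q} {s} {t} {s′} {t′} E E′ x y = ∃ λ k →
  (y ≡ x ℤ.* Powers.pow {s = s} {t} E k [mod p ]) × (y ≡ x ℤ.* Powers.pow {s = s′} {t′} E′ k [mod q ])

Shift : ∀ {p q s t s′ t′} .{{_ : NonZero t}} .{{_ : NonZero t′}} →
  Exponential p (s * t) → Exponential q (s′ * t′) → ℤ → Pred ℤ 0ℓ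
Shift {s = s} {t} {s′} {t′} E E′ a x = Orbit {s = s} {t} {s′} {t′} E E′ x (x ℤ.+ a)

-- Counting the solutions of the shift equation

value : ∀ {d u} → Fin d → Fin u → ℤ
value {d} r i = + toℕ r ℤ.+ + toℕ i ℤ.* + d

opaque
  -- Reduction modulo `d` reads off the low digit; once it is cancelled, dividing by `d` leaves the
  -- high digit modulo `u`.
  value-injective : ∀ {d u} .{{_ : NonZero d}} (r r′ : Fin d) (i i′ : Fin u) →
    value r i ≡ value r′ i′ [mod u * d ] → r ≡ r′ × i ≡ i′
  value-injective {d} {u} r r′ i i′ e = r≡r′ , toℕ-mod-injective (mod-unscale d
    (+-cancelˡ-mod (+ toℕ r) (≈-trans e (≡⇒≈ (cong (λ r → value r i′) (sym r≡r′))))))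
    where
    lowest : ∀ (r : Fin d) (i : Fin u) → value r i ≡ + toℕ r [mod d ]
    lowest r i = ≡+*⇒≈ _ _ (+ toℕ i) refl
    r≡r′ : r ≡ r′
    r≡r′ = toℕ-mod-injective (≈-trans (≈-sym (lowest r i)) (≈-trans (mod-∣ (ℕ∣.n∣m*n u) e) (lowest r′ i′)))

-- The exponents modulo s = u d and s′ = v d that come from a common integer are
-- those that agree modulo d, so they are given by a common lowest digit r in
-- base d and digits i < u, j < v.
module UnitShift {n p q : ℕ} (d₀ u₀ v₀ t t′ : ℕ) .{{_ : NonZero t}} .{{_ : NonZero t′}}
  (S : Split n p q) (E : Exponential p (suc u₀ * suc d₀ * t)) (E′ : Exponential q (suc v₀ * suc d₀ * t′))
  (α β : ℤ) (αs+βs′≡d : α ℤ.* + (suc u₀ * suc d₀) ℤ.+ β ℤ.* + (suc v₀ * suc d₀) ≡ + suc d₀)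
  (a : ℤ) (a≉0 : ¬ (a ≡ 0ℤ [mod p ])) (a≉0′ : ¬ (a ≡ 0ℤ [mod q ])) where
  private
    d u v : ℕ
    d = suc d₀
    u = suc u₀
    v = suc v₀
    module S = Split S
    module P = Powers {s = u * d} {t} E
    module Q = Powers {s = v * d} {t′} E′

  -- The exponents must be nonzero modulo both `s` and `s′`. A nonzero common digit ensures this for
  -- all `i` and `j`; if it is zero, both `i` and `j` have to be nonzero.
  I : Set
  I = (Fin d₀ × Fin u × Fin v) ⊎ (Fin u₀ × Fin v₀)

  digits : I → Fin d × Fin u × Fin v
  digits (inj₁ (r , i , j)) = Fin.suc r , i , j
  digits (inj₂ (i , j))     = Fin.zero , Fin.suc i , Fin.suc j

  digits-injective : ∀ ι κ → digits ι ≡ digits κ → ι ≡ κ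
  digits-injective (inj₁ _) (inj₁ _) refl = refl
  digits-injective (inj₂ _) (inj₂ _) refl = refl

  k₁ k₂ : I → ℤ
  k₁ ι = value (proj₁ (digits ι)) (proj₁ (proj₂ (digits ι)))
  k₂ ι = value (proj₁ (digits ι)) (proj₂ (proj₂ (digits ι)))

  k₁≉0 : ∀ ι → ¬ (k₁ ι ≡ 0ℤ [mod u * d ])
  k₁≉0 (inj₁ (r , i , j)) e = contradiction (proj₁ (value-injective (Fin.suc r) Fin.zero i Fin.zero e)) λ ()
  k₁≉0 (inj₂ (i , j)) e = contradiction (proj₂ (value-injective (Fin.zero {d₀}) Fin.zero (Fin.suc i) Fin.zero e)) λ ()

  k₂≉0 : ∀ ι → ¬ (k₂ ι ≡ 0ℤ [mod v * d ])
  k₂≉0 (inj₁ (r , i , j)) e = contradiction (proj₁ (value-injective (Fin.suc r) Fin.zero j Fin.zero e)) λ ()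
  k₂≉0 (inj₂ (i , j)) e = contradiction (proj₂ (value-injective (Fin.zero {d₀}) Fin.zero (Fin.suc j) Fin.zero e)) λ ()

  digits-surjective : ∀ (r : Fin d) (i : Fin u) (j : Fin v) →
    ¬ (value r i ≡ 0ℤ [mod u * d ]) → ¬ (value r j ≡ 0ℤ [mod v * d ]) → ∃ λ ι → digits ι ≡ (r , i , j)
  digits-surjective (Fin.suc r) i           j           _    _    = inj₁ (r , i , j) , refl
  digits-surjective Fin.zero    (Fin.suc i) (Fin.suc j) _    _    = inj₂ (i , j) , refl
  digits-surjective Fin.zero    Fin.zero    _           k₁≉0 _    = contradiction ≈-refl k₁≉0
  digits-surjective Fin.zero    (Fin.suc i) Fin.zero    _    k₂≉0 = contradiction ≈-refl k₂≉0

  -- The two values differ by `(i - j) d = (i - j) α s + (i - j) β s′`. Subtracting the first term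
  -- from `value r i` gives the same number as adding the second to `value r j`.
  common-exponent : ∀ (r : Fin d) (i : Fin u) (j : Fin v) →
    ∃ λ k → k ≡ value r i [mod u * d ] × k ≡ value r j [mod v * d ]
  common-exponent r i j = value r i ℤ.+ c ℤ.* + (u * d) , ≡+*⇒≈ _ _ c refl ,
    ≡+*⇒≈ _ _ ((+ toℕ i ℤ.- + toℕ j) ℤ.* β)
      (lem (+ toℕ r) (+ toℕ i) (+ toℕ j) α β (+ (u * d)) (+ (v * d)) (+ d) αs+βs′≡d)
    where
    c = ℤ.- ((+ toℕ i ℤ.- + toℕ j) ℤ.* α)
    lem : ∀ r i j α β s s′ d → α ℤ.* s ℤ.+ β ℤ.* s′ ≡ d →
      r ℤ.+ i ℤ.* d ℤ.+ ℤ.- ((i ℤ.- j) ℤ.* α) ℤ.* s ≡ r ℤ.+ j ℤ.* d ℤ.+ (i ℤ.- j) ℤ.* β ℤ.* s′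
    lem r i j α β s s′ _ refl = lem′ r i j α β s s′
      where
      lem′ : ∀ r i j α β s s′ →
        r ℤ.+ i ℤ.* (α ℤ.* s ℤ.+ β ℤ.* s′) ℤ.+ ℤ.- ((i ℤ.- j) ℤ.* α) ℤ.* s ≡
        r ℤ.+ j ℤ.* (α ℤ.* s ℤ.+ β ℤ.* s′) ℤ.+ (i ℤ.- j) ℤ.* β ℤ.* s′
      lem′ = solve-∀

  solution : ∀ ι → ∃ λ x → P.Solves a (k₁ ι) x × Q.Solves a (k₂ ι) x
  solution ι = w , P.solves-cong x₁ w (≈-sym w≈x₁) ≈-refl e₁ , Q.solves-cong x₂ w (≈-sym w≈x₂) ≈-refl e₂
    where
    x₁ = proj₁ (P.solution a (k₁≉0 ι))
    x₂ = proj₁ (Q.solution a (k₂≉0 ι))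
    e₁ = proj₂ (P.solution a (k₁≉0 ι))
    e₂ = proj₂ (Q.solution a (k₂≉0 ι))
    w = proj₁ (S.pair x₁ x₂)
    w≈x₁ = proj₁ (proj₂ (S.pair x₁ x₂))
    w≈x₂ = proj₂ (proj₂ (S.pair x₁ x₂))

  f : I → ℤ
  f ι = proj₁ (solution ι)

  f-solves₁ : ∀ ι → P.Solves a (k₁ ι) (f ι)
  f-solves₁ ι = proj₁ (proj₂ (solution ι))

  f-solves₂ : ∀ ι → Q.Solves a (k₂ ι) (f ι)
  f-solves₂ ι = proj₂ (proj₂ (solution ι))

  -- The solution was glued from two exponents chosen separately; `Shift` demands a single one,
  -- congruent to `k₁ ι` and to `k₂ ι`.
  f-shift : ∀ ι → Shift {s = u * d} {t} {v * d} {t′} E E′ a (f ι)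
  f-shift ι = l ,
    P.solves⇒shift a l (f ι) (P.solves-cong (f ι) (f ι) ≈-refl (≈-sym l≈k₁) (f-solves₁ ι)) ,
    Q.solves⇒shift a l (f ι) (Q.solves-cong (f ι) (f ι) ≈-refl (≈-sym l≈k₂) (f-solves₂ ι))
    where
    common = common-exponent (proj₁ (digits ι)) (proj₁ (proj₂ (digits ι))) (proj₂ (proj₂ (digits ι)))
    l = proj₁ common
    l≈k₁ = proj₁ (proj₂ common)
    l≈k₂ = proj₂ (proj₂ common)

  f-injective : ∀ ι κ → f ι ≡ f κ [mod n ] → ι ≡ κ
  f-injective ι κ e = digits-injective ι κ (cong₂ _,_ (proj₁ e₁) (cong₂ _,_ (proj₂ e₁) (proj₂ e₂)))
    where
    e₁ = value-injective _ _ _ _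
      (P.solves-exponent (f ι) (f κ) a≉0 (S.toˡ e) (f-solves₁ ι) (f-solves₁ κ))
    e₂ = value-injective _ _ _ _
      (Q.solves-exponent (f ι) (f κ) a≉0′ (S.toʳ e) (f-solves₂ ι) (f-solves₂ κ))

  f-surjective : ∀ x → Shift {s = u * d} {t} {v * d} {t′} E E′ a x → ∃ λ ι → f ι ≡ x [mod n ]
  f-surjective x (k , e₁ , e₂) = from-digits
    (digits-surjective r i j
      (λ k₁≈0 → P.solves-≉0 x a≉0 x-solves₁ (≈-trans k≈₁ k₁≈0))
      (λ k₂≈0 → Q.solves-≉0 x a≉0′ x-solves₂ (≈-trans k≈₂ k₂≈0)))
    where
    x-solves₁ = P.shift⇒solves a k x e₁
    x-solves₂ = Q.shift⇒solves a k x e₂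
    -- Division by `d` yields the shared digit `r` and one quotient `c`; the digits `i` and `j` are
    -- both residues of this `c`.
    r = proj₁ (residue d k)
    c = proj₁ (≈⇒≡+* (proj₂ (residue d k)))
    k≡ : k ≡ + toℕ r ℤ.+ c ℤ.* + d
    k≡ = proj₂ (≈⇒≡+* (proj₂ (residue d k)))
    i = proj₁ (residue u c)
    j = proj₁ (residue v c)
    k≈₁ : k ≡ value r i [mod u * d ]
    k≈₁ = ≈-trans (≡⇒≈ k≡) (+-mod (≈-refl {x = + toℕ r}) (mod-scale d (proj₂ (residue u c))))
    k≈₂ : k ≡ value r j [mod v * d ]
    k≈₂ = ≈-trans (≡⇒≈ k≡) (+-mod (≈-refl {x = + toℕ r}) (mod-scale d (proj₂ (residue v c))))
    from-digits : (∃ λ ι → digits ι ≡ (r , i , j)) → ∃ λ ι → f ι ≡ x [mod n ]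
    from-digits (ι , digits≡) = ι , S.from
      (P.solves-unique (f ι) x (k₁≉0 ι) (f-solves₁ ι)
        (P.solves-cong x x ≈-refl (≈-trans k≈₁ (≡⇒≈ (sym (cong (λ (r , i , j) → value r i) digits≡)))) x-solves₁))
      (Q.solves-unique (f ι) x (k₂≉0 ι) (f-solves₂ ι)
        (Q.solves-cong x x ≈-refl (≈-trans k≈₂ (≡⇒≈ (sym (cong (λ (r , i , j) → value r j) digits≡)))) x-solves₂))

  size : HasSize (subsetoid (CommutativeRing.setoid (ℤ/ n)) (Shift {s = u * d} {t} {v * d} {t′} E E′ a))
    (d₀ * (u * v) + u₀ * v₀)
  size = enumerate ((((↔-id _ ×-↔ Fin.*↔×) ↔-∘ Fin.*↔×) ⊎-↔ Fin.*↔×) ↔-∘ Fin.+↔⊎) f f-shift f-injective f-surjective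

-- Here a is divisible by q only, so either x = 0 modulo q or ω = 1 modulo q, and in
-- the second case the exponent of ω is a multiple of s′.
module DivisorShift {n p q : ℕ} (s₀ u₀ v d t s′ t′ : ℕ)
  .{{_ : NonZero d}} .{{_ : NonZero t}} .{{_ : NonZero s′}} .{{_ : NonZero t′}}
  (s≡ud : suc s₀ ≡ suc u₀ * d) (s′≡vd : s′ ≡ v * d)
  (S : Split n p q) (E : Exponential p (suc s₀ * t)) (E′ : Exponential q (s′ * t′))
  (α β : ℤ) (αs+βs′≡d : α ℤ.* + suc s₀ ℤ.+ β ℤ.* + s′ ≡ + d)
  (a : ℤ) (a≉0 : ¬ (a ≡ 0ℤ [mod p ])) (a≈0 : a ≡ 0ℤ [mod q ]) where
  private
    s u : ℕ
    s = suc s₀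
    u = suc u₀
    module S = Split S
    module P = Powers {s = s} {t} E
    module Q = Powers {s = s′} {t′} E′
    nonZero-s′t′ : NonZero (s′ * t′)
    nonZero-s′t′ = ℕ.m*n≢0 s′ t′

  -- `inj₁` is `x = 0` modulo `q` with any of the `s₀` nonzero exponents. `inj₂` is a logarithm of
  -- `x` modulo `q` with a multiplier of `s′` that is nonzero modulo `u`, since ω must differ from 1
  -- modulo `p`.
  I : Set
  I = Fin s₀ ⊎ (Fin (s′ * t′) × Fin u₀)

  -- Multiplication by `β` turns `i s′` into `i d` modulo `s = u d`, where `d` can be cancelled.
  -- With `*s′-cong` this says that `s′` has additive order `u` modulo `s`.
  *s′-injective : ∀ i j → i ℤ.* + s′ ≡ j ℤ.* + s′ [mod s ] → i ≡ j [mod u ]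
  *s′-injective i j e = mod-unscale d (subst (λ k → i ℤ.* + d ≡ j ℤ.* + d [mod k ]) s≡ud
    (≈-trans (*d≈ i) (≈-trans (*-modˡ β e) (≈-sym (*d≈ j)))))
    where
    lem : ∀ i α β s s′ → i ℤ.* (α ℤ.* s ℤ.+ β ℤ.* s′) ≡ β ℤ.* (i ℤ.* s′) ℤ.+ i ℤ.* α ℤ.* s
    lem = solve-∀
    *d≈ : ∀ i → i ℤ.* + d ≡ β ℤ.* (i ℤ.* + s′) [mod s ]
    *d≈ i = ≡+*⇒≈ _ _ (i ℤ.* α) (trans (cong (i ℤ.*_) (sym αs+βs′≡d)) (lem i α β (+ s) (+ s′)))

  s∣u*s′ : s ∣ u * s′
  s∣u*s′ = subst₂ _∣_ (sym s≡ud) (cong (u *_) (sym s′≡vd)) (ℕ∣.*-monoʳ-∣ u (ℕ∣.n∣m*n v))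

  *s′-cong : ∀ {i j} → i ≡ j [mod u ] → i ℤ.* + s′ ≡ j ℤ.* + s′ [mod s ]
  *s′-cong e = mod-∣ s∣u*s′ (mod-scale s′ e)

  k : I → ℤ
  k (inj₁ i)       = + suc (toℕ i)
  k (inj₂ (j , i)) = + suc (toℕ i) ℤ.* + s′

  k≉0 : ∀ ι → ¬ (k ι ≡ 0ℤ [mod s ])
  k≉0 (inj₁ i)         = suc≉0 i
  k≉0 (inj₂ (j , i)) e = suc≉0 i (*s′-injective (+ suc (toℕ i)) 0ℤ (≈-trans e (≡⇒≈ (sym (ℤ.*-zeroˡ (+ s′))))))

  x′ : I → ℤ
  x′ (inj₁ i)       = 0ℤ
  x′ (inj₂ (j , i)) = Q.exp (+ toℕ j)

  f : I → ℤ
  f ι = proj₁ (S.pair (proj₁ (P.solution a (k≉0 ι))) (x′ ι))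

  f-solves : ∀ ι → P.Solves a (k ι) (f ι)
  f-solves ι = P.solves-cong (proj₁ (P.solution a (k≉0 ι))) (f ι)
    (≈-sym (proj₁ (proj₂ (S.pair (proj₁ (P.solution a (k≉0 ι))) (x′ ι))))) ≈-refl (proj₂ (P.solution a (k≉0 ι)))

  f≈x′ : ∀ ι → f ι ≡ x′ ι [mod q ]
  f≈x′ ι = proj₂ (proj₂ (S.pair (proj₁ (P.solution a (k≉0 ι))) (x′ ι)))

  x′-solves : ∀ ι → Q.Solves a (k ι) (x′ ι)
  x′-solves (inj₁ i)       = Q.solves-0 0ℤ a≈0 ≈-refl
  x′-solves (inj₂ (j , i)) = Q.solves-period (Q.exp (+ toℕ j)) a≈0
    (≡+*⇒≈ _ _ (+ suc (toℕ i)) (sym (ℤ.+-identityˡ (+ suc (toℕ i) ℤ.* + s′))))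

  f-shift : ∀ ι → Shift {s = s} {t} {s′} {t′} E E′ a (f ι)
  f-shift ι = k ι , P.solves⇒shift a (k ι) (f ι) (f-solves ι) ,
    Q.solves⇒shift a (k ι) (f ι) (Q.solves-cong (x′ ι) (f ι) (≈-sym (f≈x′ ι)) ≈-refl (x′-solves ι))

  f-injective : ∀ ι κ → f ι ≡ f κ [mod n ] → ι ≡ κ
  f-injective ι κ e = decode ι κ
    (P.solves-exponent (f ι) (f κ) a≉0 (S.toˡ e) (f-solves ι) (f-solves κ))
    (≈-trans (≈-sym (f≈x′ ι)) (≈-trans (S.toʳ e) (f≈x′ κ)))
    where
    decode : ∀ ι κ → k ι ≡ k κ [mod s ] → x′ ι ≡ x′ κ [mod q ] → ι ≡ κ
    decode (inj₁ i) (inj₁ i′) e _ = cong inj₁ (suc-mod-injective e)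
    decode (inj₁ i) (inj₂ (j , _)) _ e = contradiction (≈-sym e) (Q.exp≉0 (+ toℕ j))
    decode (inj₂ (j , _)) (inj₁ i) _ e = contradiction e (Q.exp≉0 (+ toℕ j))
    decode (inj₂ (j , i)) (inj₂ (j′ , i′)) e e′ = cong₂ (λ j i → inj₂ (j , i))
      (toℕ-mod-injective (Q.exp-injective e′))
      (suc-mod-injective (*s′-injective (+ suc (toℕ i)) (+ suc (toℕ i′)) e))

  f-surjective : ∀ x → Shift {s = s} {t} {s′} {t′} E E′ a x → ∃ λ ι → f ι ≡ x [mod n ]
  f-surjective x (l , e , e′) = cases (≈0? q x)
    where
    x-solves = P.shift⇒solves a l x e
    x-solves′ = Q.shift⇒solves a l x e′

    l≉0 : ¬ (l ≡ 0ℤ [mod s ])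
    l≉0 = P.solves-≉0 x a≉0 x-solves

    f≈x : ∀ ι → l ≡ k ι [mod s ] → x ≡ x′ ι [mod q ] → f ι ≡ x [mod n ]
    f≈x ι l≈ x≈ = S.from
      (P.solves-unique (f ι) x (k≉0 ι) (f-solves ι) (P.solves-cong x x ≈-refl l≈ x-solves))
      (≈-trans (f≈x′ ι) (≈-sym x≈))

    cases : Dec (x ≡ 0ℤ [mod q ]) → ∃ λ ι → f ι ≡ x [mod n ]
    cases (yes x≈0) = inj₁ i , f≈x (inj₁ i) (proj₂ (nonzero-residue s₀ l≉0)) x≈0
      where i = proj₁ (nonzero-residue s₀ l≉0)
    cases (no x≉0) = inj₂ (j , i) , f≈x (inj₂ (j , i))
      (≈-trans (≡⇒≈ l≡cs′) (*s′-cong (proj₂ (nonzero-residue u₀ c≉0))))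
      (≈-trans (proj₂ (Q.log x≉0)) (Q.exp-cong (proj₂ (residue (s′ * t′) {{nonZero-s′t′}} b))))
      where
      b = proj₁ (Q.log x≉0)
      j = proj₁ (residue (s′ * t′) {{nonZero-s′t′}} b)
      l≈0′ : l ≡ 0ℤ [mod s′ ]
      l≈0′ = Q.solves-0⇒period x a≈0 x≉0 x-solves′
      c = proj₁ (≈⇒≡+* l≈0′)
      l≡cs′ : l ≡ c ℤ.* + s′
      l≡cs′ = trans (proj₂ (≈⇒≡+* l≈0′)) (ℤ.+-identityˡ (c ℤ.* + s′))
      c≉0 : ¬ (c ≡ 0ℤ [mod u ])
      c≉0 c≈0 = l≉0 (≈-trans (≡⇒≈ l≡cs′) (*s′-cong c≈0))
      i = proj₁ (nonzero-residue u₀ c≉0)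

  size : HasSize (subsetoid (CommutativeRing.setoid (ℤ/ n)) (Shift {s = s} {t} {s′} {t′} E E′ a)) (s₀ + s′ * t′ * u₀)
  size = enumerate ((↔-id _ ⊎-↔ Fin.*↔×) ↔-∘ Fin.+↔⊎) f f-shift f-injective f-surjective

HasSize-≐ : ∀ {a ℓ ℓ′ ℓ″} {S : Setoid a ℓ} {P : Pred (Setoid.Carrier S) ℓ′} {Q : Pred (Setoid.Carrier S) ℓ″} {k : ℕ} →
  P ≐ Q → HasSize (subsetoid S P) k → HasSize (subsetoid S Q) k
HasSize-≐ (P⊆Q , Q⊆P) b = record
  { to        = λ i → let (x , Px) = to i in x , P⊆Q Px
  ; cong      = cong-to
  ; bijective = injective , λ (x , Qx) → surjective (x , Q⊆P Qx)
  }
  where open Bijection b renaming (cong to cong-to)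

distinct-primes⇒coprime : ∀ {p q} → Prime p → Prime q → p ≢ q → gcd p q ≡ 1
distinct-primes⇒coprime {p} {q} pr pr′ p≢q with prime⇒irreducible pr (gcd[m,n]∣m p q)
... | inj₁ gcd≡1 = gcd≡1
... | inj₂ gcd≡p with prime⇒irreducible pr′ (subst (_∣ q) gcd≡p (gcd[m,n]∣n p q))
...   | inj₁ refl = contradiction pr ¬prime[1]
...   | inj₂ p≡q  = contradiction p≡q p≢q

-- Counting the orbits

module Representatives {n p q : ℕ} (s t s′ t′ d : ℕ)
  .{{_ : NonZero t}} .{{_ : NonZero t′}} .{{_ : NonZero d}}
  (S : Split n p q) (E : Exponential p (s * t)) (E′ : Exponential q (s′ * t′))
  (d∣s : d ∣ s) (d∣s′ : d ∣ s′) (α β : ℤ) (αs+βs′≡d : α ℤ.* + s ℤ.+ β ℤ.* + s′ ≡ + d) where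
  private
    module S = Split S
    module P = Powers {s = s} {t} E
    module Q = Powers {s = s′} {t′} E′
    nonZero-dt : NonZero (d * t)
    nonZero-dt = ℕ.m*n≢0 d t

  -- One summand for each pattern of zero coordinates, which multiplication by units preserves. With
  -- a single nonzero coordinate the coupling of the two moduli is invisible, so its logarithm
  -- counts modulo `t` or `t′` only.
  I : Set
  I = ((Fin 1 ⊎ Fin t) ⊎ Fin t′) ⊎ (Fin (d * t) × Fin t′)

  pattern zero-zero    = inj₁ (inj₁ (inj₁ Fin.zero))
  pattern power-zero i = inj₁ (inj₁ (inj₂ i))
  pattern zero-power j = inj₁ (inj₂ j)
  pattern power-power i j = inj₂ (i , j)

  X Y : I → ℤ
  X zero-zero         = 0ℤ
  X (power-zero i)    = P.exp (+ toℕ i)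
  X (zero-power j)    = 0ℤ
  X (power-power i j) = P.exp (+ toℕ i)
  Y zero-zero         = 0ℤ
  Y (power-zero i)    = 0ℤ
  Y (zero-power j)    = Q.exp (+ toℕ j)
  Y (power-power i j) = Q.exp (+ toℕ j)

  rep : I → ℤ
  rep ι = proj₁ (S.pair (X ι) (Y ι))

  rep≈X : ∀ ι → rep ι ≡ X ι [mod p ]
  rep≈X ι = proj₁ (proj₂ (S.pair (X ι) (Y ι)))

  rep≈Y : ∀ ι → rep ι ≡ Y ι [mod q ]
  rep≈Y ι = proj₂ (proj₂ (S.pair (X ι) (Y ι)))

  ≈-mod-∣ : ∀ {c m} → c ∣ m → ∀ i j k → j ≡ i ℤ.+ k [mod m ] → k ≡ 0ℤ [mod c ] → j ≡ i [mod c ]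
  ≈-mod-∣ c∣m i j k e k≈0 = ≈-trans (mod-∣ c∣m e) (≈-trans (+-mod (≈-refl {x = i}) k≈0) (≡⇒≈ (ℤ.+-identityʳ i)))

  -- In the last case, reducing logarithms modulo `t′` gives `j = j′`, which forces `s′` to divide
  -- `k`. Then `d` divides `k`, so `k t` vanishes modulo `d t` and `i = i′`.
  separated : ∀ ι κ k → X κ ≡ X ι ℤ.* P.pow k [mod p ] → Y κ ≡ Y ι ℤ.* Q.pow k [mod q ] → ι ≡ κ
  separated zero-zero         zero-zero           k e e′ = refl
  separated zero-zero         (power-zero i′)     k e e′ = contradiction e (P.exp≉0*pow (+ toℕ i′) k)
  separated zero-zero         (zero-power j′)     k e e′ = contradiction e′ (Q.exp≉0*pow (+ toℕ j′) k)
  separated zero-zero         (power-power i′ j′) k e e′ = contradiction e (P.exp≉0*pow (+ toℕ i′) k)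
  separated (power-zero i)    zero-zero           k e e′ = contradiction e (P.0≉exp*pow (+ toℕ i) k)
  separated (power-zero i)    (power-zero i′)     k e e′ = cong (inj₁ ∘ inj₁ ∘ inj₂) (toℕ-mod-injective (≈-sym
    (≈-mod-∣ (ℕ∣.n∣m*n s) (+ toℕ i) (+ toℕ i′) (k ℤ.* + t) (P.exp-*-pow-injective (+ toℕ i) (+ toℕ i′) k e)
      (≡+*⇒≈ _ _ k (sym (ℤ.+-identityˡ (k ℤ.* + t)))))))
  separated (power-zero i)    (zero-power j′)     k e e′ = contradiction e (P.0≉exp*pow (+ toℕ i) k)
  separated (power-zero i)    (power-power i′ j′) k e e′ = contradiction e′ (Q.exp≉0*pow (+ toℕ j′) k)
  separated (zero-power j)    zero-zero           k e e′ = contradiction e′ (Q.0≉exp*pow (+ toℕ j) k)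
  separated (zero-power j)    (power-zero i′)     k e e′ = contradiction e (P.exp≉0*pow (+ toℕ i′) k)
  separated (zero-power j)    (zero-power j′)     k e e′ = cong (inj₁ ∘ inj₂) (toℕ-mod-injective (≈-sym
    (≈-mod-∣ (ℕ∣.n∣m*n s′) (+ toℕ j) (+ toℕ j′) (k ℤ.* + t′) (Q.exp-*-pow-injective (+ toℕ j) (+ toℕ j′) k e′)
      (≡+*⇒≈ _ _ k (sym (ℤ.+-identityˡ (k ℤ.* + t′)))))))
  separated (zero-power j)    (power-power i′ j′) k e e′ = contradiction e (P.exp≉0*pow (+ toℕ i′) k)
  separated (power-power i j) zero-zero           k e e′ = contradiction e (P.0≉exp*pow (+ toℕ i) k)
  separated (power-power i j) (power-zero i′)     k e e′ = contradiction e′ (Q.0≉exp*pow (+ toℕ j) k)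
  separated (power-power i j) (zero-power j′)     k e e′ = contradiction e (P.0≉exp*pow (+ toℕ i) k)
  separated (power-power i j) (power-power i′ j′) k e e′ = cong₂ (λ i j → inj₂ (i , j)) i≡i′ j≡j′
    where
    e″ : + toℕ j′ ≡ + toℕ j ℤ.+ k ℤ.* + t′ [mod s′ * t′ ]
    e″ = Q.exp-*-pow-injective (+ toℕ j) (+ toℕ j′) k e′
    j≡j′ : j ≡ j′
    j≡j′ = toℕ-mod-injective (≈-sym (≈-mod-∣ (ℕ∣.n∣m*n s′) (+ toℕ j) (+ toℕ j′) (k ℤ.* + t′) e″
      (≡+*⇒≈ _ _ k (sym (ℤ.+-identityˡ (k ℤ.* + t′))))))
    k≈0 : k ≡ 0ℤ [mod s′ ]
    k≈0 = mod-unscale t′ (≈-trans (+-cancelˡ-mod (+ toℕ j) (≈-trans (≈-sym e″)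
      (≡⇒≈ (trans (cong (λ j → + toℕ j) (sym j≡j′)) (sym (ℤ.+-identityʳ (+ toℕ j))))))) (≡⇒≈ (sym (ℤ.*-zeroˡ (+ t′)))))
    i≡i′ : i ≡ i′
    i≡i′ = toℕ-mod-injective (≈-sym (≈-mod-∣ (ℕ∣.*-monoˡ-∣ t d∣s) (+ toℕ i) (+ toℕ i′) (k ℤ.* + t)
      (P.exp-*-pow-injective (+ toℕ i) (+ toℕ i′) k e)
      (≈-trans (mod-scale t (mod-∣ d∣s′ k≈0)) (≡⇒≈ (ℤ.*-zeroˡ (+ t))))))

  Covers : ℤ → I → Set
  Covers x ι = ∃ λ k → (x ≡ X ι ℤ.* P.pow k [mod p ]) × (x ≡ Y ι ℤ.* Q.pow k [mod q ])

  cover : ∀ x → ∃ (Covers x)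
  cover x = cases (≈0? p x) (≈0? q x)
    where
    0≈0* : ∀ {m} w → x ≡ 0ℤ [mod m ] → x ≡ 0ℤ ℤ.* w [mod m ]
    0≈0* w x≈0 = ≈-trans x≈0 (≡⇒≈ (sym (ℤ.*-zeroˡ w)))

    cases : Dec (x ≡ 0ℤ [mod p ]) → Dec (x ≡ 0ℤ [mod q ]) → ∃ (Covers x)
    cases (yes x≈0) (yes x≈0′) = zero-zero , 0ℤ , 0≈0* (P.pow 0ℤ) x≈0 , 0≈0* (Q.pow 0ℤ) x≈0′
    cases (no x≉0) (yes x≈0′) = power-zero i , k ,
      P.exp-*-pow-cong _ (+ toℕ i) k (proj₂ (P.log x≉0)) (≡⇒≈ b≡) , 0≈0* (Q.pow k) x≈0′
      where
      b = proj₁ (P.log x≉0)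
      i = proj₁ (residue t b)
      k = proj₁ (≈⇒≡+* (proj₂ (residue t b)))
      b≡ : b ≡ + toℕ i ℤ.+ k ℤ.* + t
      b≡ = proj₂ (≈⇒≡+* (proj₂ (residue t b)))
    cases (yes x≈0) (no x≉0) = zero-power j , k ,
      0≈0* (P.pow k) x≈0 , Q.exp-*-pow-cong _ (+ toℕ j) k (proj₂ (Q.log x≉0)) (≡⇒≈ b≡)
      where
      b = proj₁ (Q.log x≉0)
      j = proj₁ (residue t′ b)
      k = proj₁ (≈⇒≡+* (proj₂ (residue t′ b)))
      b≡ : b ≡ + toℕ j ℤ.+ k ℤ.* + t′
      b≡ = proj₂ (≈⇒≡+* (proj₂ (residue t′ b)))
    cases (no x≉0) (no x≉0′) = power-power i j , k ,
      P.exp-*-pow-cong b (+ toℕ i) k (proj₂ (P.log x≉0)) b≈ , Q.exp-*-pow-cong c (+ toℕ j) k (proj₂ (Q.log x≉0′)) c≈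
      where
      b = proj₁ (P.log x≉0)
      c = proj₁ (Q.log x≉0′)
      j = proj₁ (residue t′ c)
      k₀ = proj₁ (≈⇒≡+* (proj₂ (residue t′ c)))
      c≡ : c ≡ + toℕ j ℤ.+ k₀ ℤ.* + t′
      c≡ = proj₂ (≈⇒≡+* (proj₂ (residue t′ c)))
      i = proj₁ (residue (d * t) {{nonZero-dt}} (b ℤ.- k₀ ℤ.* + t))
      l = proj₁ (≈⇒≡+* (proj₂ (residue (d * t) {{nonZero-dt}} (b ℤ.- k₀ ℤ.* + t))))
      b-≡ : b ℤ.- k₀ ℤ.* + t ≡ + toℕ i ℤ.+ l ℤ.* + (d * t)
      b-≡ = proj₂ (≈⇒≡+* (proj₂ (residue (d * t) {{nonZero-dt}} (b ℤ.- k₀ ℤ.* + t))))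
      -- `k₀` settles the second coordinate, and adding multiples of `s′` preserves it. As `l β s′`
      -- is `l d` modulo `s`, it supplies exactly the correction still missing in the first.
      k = k₀ ℤ.+ l ℤ.* β ℤ.* + s′
      c≈ : c ≡ + toℕ j ℤ.+ k ℤ.* + t′ [mod s′ * t′ ]
      c≈ = ≈-trans (≡⇒≈ c≡) (+-mod (≈-refl {x = + toℕ j}) (mod-scale {x = k₀} {k} t′ (≈-sym (≡+*⇒≈ k k₀ (l ℤ.* β) refl))))
      b≈ : b ≡ + toℕ i ℤ.+ k ℤ.* + t [mod s * t ]
      b≈ = ≈-trans (≡⇒≈ (trans (lem b (k₀ ℤ.* + t))
        (trans (cong (ℤ._+ k₀ ℤ.* + t) (trans b-≡ (cong (λ z → + toℕ i ℤ.+ l ℤ.* z) (ℤ.pos-* d t))))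
        (lem′ (+ toℕ i) l (+ d) (+ t) k₀)))) (+-mod (≈-refl {x = + toℕ i}) (mod-scale t ld≈))
        where
        lem : ∀ b c → b ≡ b ℤ.- c ℤ.+ c
        lem = solve-∀
        lem′ : ∀ i l d t k → i ℤ.+ l ℤ.* (d ℤ.* t) ℤ.+ k ℤ.* t ≡ i ℤ.+ (k ℤ.+ l ℤ.* d) ℤ.* t
        lem′ = solve-∀
        lem″ : ∀ k l α β s s′ → k ℤ.+ l ℤ.* (α ℤ.* s ℤ.+ β ℤ.* s′) ≡ k ℤ.+ l ℤ.* β ℤ.* s′ ℤ.+ l ℤ.* α ℤ.* s
        lem″ = solve-∀
        ld≈ : k₀ ℤ.+ l ℤ.* + d ≡ k [mod s ]
        ld≈ = ≡+*⇒≈ _ _ (l ℤ.* α) (trans (cong (λ z → k₀ ℤ.+ l ℤ.* z) (sym αs+βs′≡d)) (lem″ k₀ l α β (+ s) (+ s′)))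

  -- Only the fibres of `F` enter, so the result is the same for every numbering of the cosets.
  image-size : ∀ {a ℓ} {B : Setoid a ℓ} (F : Func (CommutativeRing.setoid (ℤ/ n)) B) →
    (∀ x y → Setoid._≈_ B (Func.to F x) (Func.to F y) → Orbit {s = s} {t} {s′} {t′} E E′ x y) →
    (∀ x y → Orbit {s = s} {t} {s′} {t′} E E′ x y → Setoid._≈_ B (Func.to F x) (Func.to F y)) →
    HasSize (image F) (1 + t + t′ + d * t * t′)
  image-size {B = B} F F≈⇒orbit orbit⇒F≈ = enumerate
    ((((Fin.+↔⊎ ⊎-↔ ↔-id _) ↔-∘ Fin.+↔⊎) ⊎-↔ Fin.*↔×) ↔-∘ Fin.+↔⊎)
    (λ ι → Func.to F (rep ι)) (λ ι → rep ι , B.refl) injective surjective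
    where
    module B = Setoid B
    injective : ∀ ι κ → Func.to F (rep ι) B.≈ Func.to F (rep κ) → ι ≡ κ
    injective ι κ e = separated ι κ (proj₁ orbit)
      (≈-trans (≈-sym (rep≈X κ)) (≈-trans (proj₁ (proj₂ orbit)) (*-modʳ (P.pow (proj₁ orbit)) (rep≈X ι))))
      (≈-trans (≈-sym (rep≈Y κ)) (≈-trans (proj₂ (proj₂ orbit)) (*-modʳ (Q.pow (proj₁ orbit)) (rep≈Y ι))))
      where orbit = F≈⇒orbit (rep ι) (rep κ) e
    surjective : ∀ y → (∃ λ x → Func.to F x B.≈ y) → ∃ λ ι → Func.to F (rep ι) B.≈ y
    surjective y (x , Fx≈y) = ι , B.trans (orbit⇒F≈ (rep ι) x (k ,
        ≈-trans (proj₁ (proj₂ (proj₂ (cover x)))) (*-modʳ (P.pow k) (≈-sym (rep≈X ι))) ,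
        ≈-trans (proj₂ (proj₂ (proj₂ (cover x)))) (*-modʳ (Q.pow k) (≈-sym (rep≈Y ι))))) Fx≈y
      where
      ι = proj₁ (cover x)
      k = proj₁ (proj₂ (cover x))

-- Orbits as cosets of the generated subgroup

module CyclicSubgroup {n p q : ℕ} (s t s′ t′ : ℕ) .{{_ : NonZero t}} .{{_ : NonZero t′}}
  (S : Split n p q) (E : Exponential p (s * t)) (E′ : Exponential q (s′ * t′))
  (u : Group.Carrier (units (ℤ/ n)))
  (u≈₁ : proj₁ u ≡ Powers.pow {s = s} {t} E 1ℤ [mod p ])
  (u≈₂ : proj₁ u ≡ Powers.pow {s = s′} {t′} E′ 1ℤ [mod q ]) where
  private
    module S = Split S
    module P = Powers {s = s} {t} E
    module Q = Powers {s = s′} {t′} E′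

  IsPower : ℤ → ℤ → Set
  IsPower x k = (x ≡ P.pow k [mod p ]) × (x ≡ Q.pow k [mod q ])

  isPower-inverse : ∀ x y k → x ℤ.* y ≡ 1ℤ [mod n ] → IsPower x k → IsPower y (ℤ.- k)
  isPower-inverse x y k e (x≈₁ , x≈₂) = P.pow-inverse k x≈₁ (S.toˡ e) , Q.pow-inverse k x≈₂ (S.toʳ e)

  isPower-* : ∀ x y k l → IsPower x k → IsPower y l → IsPower (x ℤ.* y) (k ℤ.+ l)
  isPower-* x y k l (x≈₁ , x≈₂) (y≈₁ , y≈₂) =
    ≈-trans (*-mod x≈₁ y≈₁) (≈-sym (P.pow-+ k l)) , ≈-trans (*-mod x≈₂ y≈₂) (≈-sym (Q.pow-+ k l))

  generated⇒power : ∀ {v} → Generated (units (ℤ/ n)) u v → ∃ (IsPower (proj₁ v))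
  generated⇒power generator = 1ℤ , u≈₁ , u≈₂
  generated⇒power (resp v≈w v∈) with generated⇒power v∈
  ... | k , v≈₁ , v≈₂ = k , ≈-trans (≈-sym (S.toˡ v≈w)) v≈₁ , ≈-trans (≈-sym (S.toʳ v≈w)) v≈₂
  generated⇒power ε-mem = 0ℤ , ≈-sym P.pow-0 , ≈-sym Q.pow-0
  generated⇒power (∙-closed {v} {w} v∈ w∈) with generated⇒power v∈ | generated⇒power w∈
  ... | k , v≈ | l , w≈ = k ℤ.+ l , isPower-* (proj₁ v) (proj₁ w) k l v≈ w≈
  generated⇒power (⁻¹-closed {v , v′ , _ , vv′≈1} v∈) with generated⇒power v∈
  ... | k , v≈ = ℤ.- k , isPower-inverse v v′ k vv′≈1 v≈

  HasPower : ℤ → Set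
  HasPower k = ∃ λ v → Generated (units (ℤ/ n)) u v × IsPower (proj₁ v) k

  +-power⇒generated : ∀ k → HasPower (+ k)
  +-power⇒generated zero = Group.ε (units (ℤ/ n)) , ε-mem , ≈-sym P.pow-0 , ≈-sym Q.pow-0
  +-power⇒generated (suc k) with +-power⇒generated k
  ... | v , v∈ , v≈ = Group._∙_ (units (ℤ/ n)) u v , ∙-closed generator v∈ ,
    isPower-* (proj₁ u) (proj₁ v) 1ℤ (+ k) (u≈₁ , u≈₂) v≈

  power⇒generated : ∀ k → HasPower k
  power⇒generated (+ k) = +-power⇒generated k
  power⇒generated ℤ.-[1+ k ] with +-power⇒generated (suc k)
  ... | v , v∈ , v≈ = Group._⁻¹ (units (ℤ/ n)) v , ⁻¹-closed v∈ ,
    isPower-inverse (proj₁ v) (proj₁ (proj₂ v)) (+ suc k) (proj₂ (proj₂ (proj₂ v))) v≈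

  coset⇒orbit : ∀ x y → coset (ℤ/ n) (⟨_⟩ (units (ℤ/ n)) u) x y → Orbit {s = s} {t} {s′} {t′} E E′ x y
  coset⇒orbit x y (v , v∈ , y≈xv) with generated⇒power v∈
  ... | k , v≈₁ , v≈₂ = k , ≈-trans (S.toˡ y≈xv) (*-modˡ x v≈₁) , ≈-trans (S.toʳ y≈xv) (*-modˡ x v≈₂)

  orbit⇒coset : ∀ x y → Orbit {s = s} {t} {s′} {t′} E E′ x y → coset (ℤ/ n) (⟨_⟩ (units (ℤ/ n)) u) x y
  orbit⇒coset x y (k , y≈₁ , y≈₂) with power⇒generated k
  ... | v , v∈ , v≈₁ , v≈₂ = v , v∈ ,
    S.from (≈-trans y≈₁ (*-modˡ x (≈-sym v≈₁))) (≈-trans y≈₂ (*-modˡ x (≈-sym v≈₂)))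

  module _ {a ℓ} {B : Setoid a ℓ} (h : Bijection (Cosets (ℤ/ n) (⟨_⟩ (units (ℤ/ n)) u)) B) where
    private
      G = ⟨_⟩ (units (ℤ/ n)) u
      module B = Setoid B
      f = Func.to (cosetIndex (ℤ/ n) G h)

    -- Injectivity of `h` turns equal indices into equal cosets; `y` lies in its own coset, hence in
    -- that of `x`.
    cosetIndex⇒orbit : ∀ x y → f x B.≈ f y → Orbit {s = s} {t} {s′} {t′} E E′ x y
    cosetIndex⇒orbit x y e = coset⇒orbit x y
      (proj₂ (Bijection.injective h {cosetOf (ℤ/ n) G x} {cosetOf (ℤ/ n) G y} e) (∈-cosetOf (ℤ/ n) G y))

    orbit⇒cosetIndex : ∀ x y → Orbit {s = s} {t} {s′} {t′} E E′ x y → f x B.≈ f y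
    orbit⇒cosetIndex x y o = Bijection.cong h (cosetOf-unique (ℤ/ n) G (cosetOf (ℤ/ n) G x) {y} (orbit⇒coset x y o))

-- Rational values of the sizes

fromℕ-injᵘ : ∀ k → ℚ.toℚᵘ (fromℕ k) ℚᵘ.≃ mkℚᵘ (+ k) 0
fromℕ-injᵘ k = ℚ.toℚᵘ-fromℚᵘ (mkℚᵘ (+ k) 0)

opaque
  fromℕ-+ : ∀ m n → fromℕ (m + n) ≡ fromℕ m ℚ.+ fromℕ n
  fromℕ-+ m n = ℚ.toℚᵘ-injective (ℚᵘ.≃-trans (fromℕ-injᵘ (m + n)) (ℚᵘ.≃-sym
    (ℚᵘ.≃-trans (ℚ.toℚᵘ-homo-+ (fromℕ m) (fromℕ n)) (ℚᵘ.≃-trans (ℚᵘ.+-cong (fromℕ-injᵘ m) (fromℕ-injᵘ n))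
      (*≡* (cong (ℤ._* 1ℤ) (trans (cong₂ ℤ._+_ (ℤ.*-identityʳ (+ m)) (ℤ.*-identityʳ (+ n))) (sym (ℤ.pos-+ m n)))))))))

  fromℕ-* : ∀ m n → fromℕ (m * n) ≡ fromℕ m ℚ.* fromℕ n
  fromℕ-* m n = ℚ.toℚᵘ-injective (ℚᵘ.≃-trans (fromℕ-injᵘ (m * n)) (ℚᵘ.≃-sym
    (ℚᵘ.≃-trans (ℚ.toℚᵘ-homo-* (fromℕ m) (fromℕ n)) (ℚᵘ.≃-trans (ℚᵘ.*-cong (fromℕ-injᵘ m) (fromℕ-injᵘ n))
      (*≡* (cong (ℤ._* 1ℤ) (sym (ℤ.pos-* m n))))))))

  1/-inverse : ∀ d .{{_ : NonZero d}} → + 1 ℚ./ d ℚ.* fromℕ d ≡ 1ℚ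
  1/-inverse d@(suc d₀) = ℚ.toℚᵘ-injective (ℚᵘ.≃-trans (ℚ.toℚᵘ-homo-* (+ 1 ℚ./ d) (fromℕ d))
    (ℚᵘ.≃-trans (ℚᵘ.*-cong (ℚ.toℚᵘ-fromℚᵘ (mkℚᵘ (+ 1) d₀)) (fromℕ-injᵘ d))
      (*≡* (trans (ℤ.*-identityʳ (+ 1 ℤ.* + d)) (trans (ℤ.*-identityˡ (+ d)) (sym (trans (ℤ.*-identityˡ _) (cong +_ (ℕ.*-identityʳ d)))))))))

  -- Here `c` is `1/d`: multiplying the subtraction-free count by `c`, with `d` added and
  -- subtracted, isolates `k`.
  unit-identity : ∀ c s s′ d k → c ℚ.* d ≡ 1ℚ → k ℚ.* d ℚ.+ s ℚ.+ s′ ≡ s ℚ.* s′ ℚ.+ d →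
    c ℚ.* (s ℚ.* s′ ℚ.- s ℚ.- s′) ℚ.+ 1ℚ ≡ k
  unit-identity c s s′ d k cd≡1 e = begin
    c ℚ.* (s ℚ.* s′ ℚ.- s ℚ.- s′) ℚ.+ 1ℚ                         ≡⟨ lem c s s′ d 1ℚ ⟩
    c ℚ.* (s ℚ.* s′ ℚ.+ d ℚ.- s ℚ.- s′ ℚ.- d) ℚ.+ 1ℚ             ≡⟨ cong (λ z → c ℚ.* (z ℚ.- s ℚ.- s′ ℚ.- d) ℚ.+ 1ℚ) e ⟨
    c ℚ.* (k ℚ.* d ℚ.+ s ℚ.+ s′ ℚ.- s ℚ.- s′ ℚ.- d) ℚ.+ 1ℚ       ≡⟨ lem′ c s s′ d k 1ℚ ⟩
    k ℚ.* (c ℚ.* d) ℚ.- c ℚ.* d ℚ.+ 1ℚ                           ≡⟨ cong (λ z → k ℚ.* z ℚ.- z ℚ.+ 1ℚ) cd≡1 ⟩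
    k ℚ.* 1ℚ ℚ.- 1ℚ ℚ.+ 1ℚ                                       ≡⟨ lem″ (k ℚ.* 1ℚ) 1ℚ ⟩
    k ℚ.* 1ℚ                                                     ≡⟨ ℚ.*-identityʳ k ⟩
    k                                                            ∎
    where
    open ≡-Reasoning
    open +-*-Solver
    lem : ∀ c s s′ d i → c ℚ.* (s ℚ.* s′ ℚ.- s ℚ.- s′) ℚ.+ i ≡ c ℚ.* (s ℚ.* s′ ℚ.+ d ℚ.- s ℚ.- s′ ℚ.- d) ℚ.+ i
    lem = solve 5 (λ c s s′ d i → c :* (s :* s′ :- s :- s′) :+ i := c :* (s :* s′ :+ d :- s :- s′ :- d) :+ i) refl
    lem′ : ∀ c s s′ d k i →
      c ℚ.* (k ℚ.* d ℚ.+ s ℚ.+ s′ ℚ.- s ℚ.- s′ ℚ.- d) ℚ.+ i ≡ k ℚ.* (c ℚ.* d) ℚ.- c ℚ.* d ℚ.+ i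
    lem′ = solve 6 (λ c s s′ d k i →
      c :* (k :* d :+ s :+ s′ :- s :- s′ :- d) :+ i := k :* (c :* d) :- c :* d :+ i) refl
    lem″ : ∀ k i → k ℚ.- i ℚ.+ i ≡ k
    lem″ = solve 2 (λ k i → k :- i :+ i := k) refl

  divisor-identity : ∀ c p m s d k → c ℚ.* d ≡ 1ℚ → p ≡ 1ℚ ℚ.+ m → k ℚ.* d ℚ.+ p ℚ.* d ≡ m ℚ.* s ℚ.+ s ℚ.* d →
    (p ℚ.- 1ℚ) ℚ.* s ℚ.* c ℚ.- p ℚ.+ s ≡ k
  divisor-identity c p m s d k cd≡1 p≡ e = begin
    (p ℚ.- 1ℚ) ℚ.* s ℚ.* c ℚ.- p ℚ.+ s                            ≡⟨ cong (λ z → (z ℚ.- 1ℚ) ℚ.* s ℚ.* c ℚ.- p ℚ.+ s) p≡ ⟩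
    (1ℚ ℚ.+ m ℚ.- 1ℚ) ℚ.* s ℚ.* c ℚ.- p ℚ.+ s                     ≡⟨ lem c s d m p 1ℚ ⟩
    (m ℚ.* s ℚ.+ s ℚ.* d) ℚ.* c ℚ.- s ℚ.* (c ℚ.* d) ℚ.- p ℚ.+ s   ≡⟨ cong (λ z → z ℚ.* c ℚ.- s ℚ.* (c ℚ.* d) ℚ.- p ℚ.+ s) e ⟨
    (k ℚ.* d ℚ.+ p ℚ.* d) ℚ.* c ℚ.- s ℚ.* (c ℚ.* d) ℚ.- p ℚ.+ s   ≡⟨ lem′ c s d k p ⟩
    (k ℚ.+ p ℚ.- s) ℚ.* (c ℚ.* d) ℚ.- p ℚ.+ s                     ≡⟨ cong (λ z → (k ℚ.+ p ℚ.- s) ℚ.* z ℚ.- p ℚ.+ s) cd≡1 ⟩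
    (k ℚ.+ p ℚ.- s) ℚ.* 1ℚ ℚ.- p ℚ.+ s                            ≡⟨ cong (λ z → z ℚ.- p ℚ.+ s) (ℚ.*-identityʳ (k ℚ.+ p ℚ.- s)) ⟩
    k ℚ.+ p ℚ.- s ℚ.- p ℚ.+ s                                     ≡⟨ lem″ k p s ⟩
    k                                                             ∎
    where
    open ≡-Reasoning
    open +-*-Solver
    lem : ∀ c s d m p i →
      (i ℚ.+ m ℚ.- i) ℚ.* s ℚ.* c ℚ.- p ℚ.+ s ≡ (m ℚ.* s ℚ.+ s ℚ.* d) ℚ.* c ℚ.- s ℚ.* (c ℚ.* d) ℚ.- p ℚ.+ s
    lem = solve 6 (λ c s d m p i →
      (i :+ m :- i) :* s :* c :- p :+ s := (m :* s :+ s :* d) :* c :- s :* (c :* d) :- p :+ s) refl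
    lem′ : ∀ c s d k p →
      (k ℚ.* d ℚ.+ p ℚ.* d) ℚ.* c ℚ.- s ℚ.* (c ℚ.* d) ℚ.- p ℚ.+ s ≡ (k ℚ.+ p ℚ.- s) ℚ.* (c ℚ.* d) ℚ.- p ℚ.+ s
    lem′ = solve 5 (λ c s d k p →
      (k :* d :+ p :* d) :* c :- s :* (c :* d) :- p :+ s := (k :+ p :- s) :* (c :* d) :- p :+ s) refl
    lem″ : ∀ k p s → k ℚ.+ p ℚ.- s ℚ.- p ℚ.+ s ≡ k
    lem″ = solve 3 (λ k p s → k :+ p :- s :- p :+ s := k) refl

opaque
  unit-value : ∀ d s s′ k .{{_ : NonZero d}} → k * d + s + s′ ≡ s * s′ + d →
    + 1 ℚ./ d ℚ.* (fromℕ s ℚ.* fromℕ s′ ℚ.- fromℕ s ℚ.- fromℕ s′) ℚ.+ 1ℚ ≡ fromℕ k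
  unit-value d s s′ k e = unit-identity (+ 1 ℚ./ d) (fromℕ s) (fromℕ s′) (fromℕ d) (fromℕ k) (1/-inverse d) (begin
    fromℕ k ℚ.* fromℕ d ℚ.+ fromℕ s ℚ.+ fromℕ s′   ≡⟨ cong (λ z → z ℚ.+ fromℕ s ℚ.+ fromℕ s′) (fromℕ-* k d) ⟨
    fromℕ (k * d) ℚ.+ fromℕ s ℚ.+ fromℕ s′         ≡⟨ cong (ℚ._+ fromℕ s′) (fromℕ-+ (k * d) s) ⟨
    fromℕ (k * d + s) ℚ.+ fromℕ s′                 ≡⟨ fromℕ-+ (k * d + s) s′ ⟨
    fromℕ (k * d + s + s′)                         ≡⟨ cong fromℕ e ⟩
    fromℕ (s * s′ + d)                             ≡⟨ fromℕ-+ (s * s′) d ⟩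
    fromℕ (s * s′) ℚ.+ fromℕ d                     ≡⟨ cong (ℚ._+ fromℕ d) (fromℕ-* s s′) ⟩
    fromℕ s ℚ.* fromℕ s′ ℚ.+ fromℕ d               ∎)
    where open ≡-Reasoning

  divisor-value : ∀ d p m s k .{{_ : NonZero d}} → p ≡ suc m → k * d + p * d ≡ m * s + s * d →
    (fromℕ p ℚ.- 1ℚ) ℚ.* fromℕ s ℚ.* (+ 1 ℚ./ d) ℚ.- fromℕ p ℚ.+ fromℕ s ≡ fromℕ k
  divisor-value d p m s k p≡ e = divisor-identity (+ 1 ℚ./ d) (fromℕ p) (fromℕ m) (fromℕ s) (fromℕ d) (fromℕ k)
    (1/-inverse d) (trans (cong fromℕ p≡) (fromℕ-+ 1 m)) (begin
    fromℕ k ℚ.* fromℕ d ℚ.+ fromℕ p ℚ.* fromℕ d    ≡⟨ cong₂ ℚ._+_ (fromℕ-* k d) (fromℕ-* p d) ⟨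
    fromℕ (k * d) ℚ.+ fromℕ (p * d)                ≡⟨ fromℕ-+ (k * d) (p * d) ⟨
    fromℕ (k * d + p * d)                          ≡⟨ cong fromℕ e ⟩
    fromℕ (m * s + s * d)                          ≡⟨ fromℕ-+ (m * s) (s * d) ⟩
    fromℕ (m * s) ℚ.+ fromℕ (s * d)                ≡⟨ cong₂ ℚ._+_ (fromℕ-* m s) (fromℕ-* s d) ⟩
    fromℕ m ℚ.* fromℕ s ℚ.+ fromℕ s ℚ.* fromℕ d    ∎)
    where open ≡-Reasoning

-- Sizes of the shift sets without subtraction or division

unit-shift-size : ∀ {n p q} d u v s t s′ t′
  .{{_ : NonZero d}} .{{_ : NonZero u}} .{{_ : NonZero v}} .{{_ : NonZero t}} .{{_ : NonZero t′}} →
  s ≡ u * d → s′ ≡ v * d → Split n p q → (E : Exponential p (s * t)) (E′ : Exponential q (s′ * t′)) →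
  ∀ α β → α ℤ.* + s ℤ.+ β ℤ.* + s′ ≡ + d →
  ∀ a → ¬ (a ≡ 0ℤ [mod p ]) → ¬ (a ≡ 0ℤ [mod q ]) →
  ∃ λ k → HasSize (subsetoid (CommutativeRing.setoid (ℤ/ n)) (Shift {s = s} {t} {s′} {t′} E E′ a)) k ×
    k * d + s + s′ ≡ s * s′ + d
unit-shift-size (suc d₀) (suc u₀) (suc v₀) s t s′ t′ refl refl S E E′ α β αs+βs′≡d a a≉0 a≉0′ =
  _ , UnitShift.size d₀ u₀ v₀ t t′ S E E′ α β αs+βs′≡d a a≉0 a≉0′ , identity d₀ u₀ v₀
  where
  -- Inclusion and exclusion: of the `d u v` compatible pairs of exponents, `v` vanish in the first
  -- place, `u` in the second and one in both, leaving `d u v - u - v + 1`. The identity is this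
  -- count times `d`.
  identity : ∀ d u v → (d * (suc u * suc v) + u * v) * suc d + suc u * suc d + suc v * suc d
    ≡ suc u * suc d * (suc v * suc d) + suc d
  identity = ℕ-Solver.solve-∀

divisor-shift-size : ∀ {n p q} d u v s t s′ t′
  .{{_ : NonZero d}} .{{_ : NonZero u}} .{{_ : NonZero s}}
  .{{_ : NonZero s′}} .{{_ : NonZero t}} .{{_ : NonZero t′}} →
  s ≡ u * d → s′ ≡ v * d → Split n p q → (E : Exponential p (s * t)) (E′ : Exponential q (s′ * t′)) →
  ∀ α β → α ℤ.* + s ℤ.+ β ℤ.* + s′ ≡ + d →
  ∀ a → ¬ (a ≡ 0ℤ [mod p ]) → a ≡ 0ℤ [mod q ] →
  ∃ λ k → HasSize (subsetoid (CommutativeRing.setoid (ℤ/ n)) (Shift {s = s} {t} {s′} {t′} E E′ a)) k ×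
    k * d + suc (s′ * t′) * d ≡ s′ * t′ * s + s * d
divisor-shift-size d (suc u₀) v s@(suc s₀) t s′ t′ s≡ud s′≡vd S E E′ α β αs+βs′≡d a a≉0 a≈0 =
  _ , DivisorShift.size s₀ u₀ v d t s′ t′ s≡ud s′≡vd S E E′ α β αs+βs′≡d a a≉0 a≈0 ,
  trans (identity s₀ (s′ * t′) u₀ d) (cong (λ z → s′ * t′ * z + s * d) (sym s≡ud))
  where
  -- The count `(s - 1) + m (u - 1)`, with `m = q - 1` and the predecessors of `s` and `u` as
  -- variables, multiplied by `d`; adding `q d` removes all subtractions.
  identity : ∀ s m u d → (s + m * u) * d + suc m * d ≡ m * (suc u * d) + suc s * d
  identity = ℕ-Solver.solve-∀

mod-size : ∀ n .{{_ : NonZero n}} → HasSize (CommutativeRing.setoid (ℤ/ n)) n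
mod-size n = record
  { to        = λ i → + toℕ i
  ; cong      = λ { refl → ≈-refl }
  ; bijective = toℕ-mod-injective , λ x → proj₁ (residue n x) , λ { refl → ≈-sym (proj₂ (residue n x)) }
  }

prime≡suc : ∀ {p m} → Prime p → m ≡ p ∸ 1 → p ≡ suc m
prime≡suc {zero}  pr _  = contradiction pr ¬prime[0]
prime≡suc {suc p} _  m≡ = cong suc (sym m≡)

theorem3p10 :
    (p₁ p₂ : ℕ) → Prime p₁ → Prime p₂ → p₁ ≢ p₂ →
    (s₁ t₁ s₂ t₂ : ℕ) →
    .{{_ : NonZero s₁}} → .{{_ : NonZero t₁}} →
    .{{_ : NonZero s₂}} → .{{_ : NonZero t₂}} →
    s₁ * t₁ ≡ p₁ ∸ 1 → s₂ * t₂ ≡ p₂ ∸ 1 →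
    (g₁ : Group.Carrier (units (ℤ/ p₁))) → IsGenerator (units (ℤ/ p₁)) g₁ →
    (g₂ : Group.Carrier (units (ℤ/ p₂))) → IsGenerator (units (ℤ/ p₂)) g₂ →
    (e : ℤ) →
    (e≡₁ : e ≡ proj₁ g₁ ℤ.^ t₁ [mod p₁ ]) →
    (e≡₂ : e ≡ proj₁ g₂ ℤ.^ t₂ [mod p₂ ]) →
    let n = p₁ * p₂
        d = gcd s₁ s₂
        1/d = + 1 ℚ./ d
        G = ⟨_⟩ (units (ℤ/ n)) (unitModProduct g₁ g₂ t₁ t₂ e e≡₁ e≡₂)
        a₀ = 1/d ℚ.* (fromℕ s₁ ℚ.* fromℕ s₂ ℚ.- fromℕ s₁ ℚ.- fromℕ s₂) ℚ.+ 1ℚ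
        a₁ = (fromℕ p₁ ℚ.- 1ℚ) ℚ.* fromℕ s₂ ℚ.* 1/d ℚ.- fromℕ p₁ ℚ.+ fromℕ s₂
        a₂ = (fromℕ p₂ ℚ.- 1ℚ) ℚ.* fromℕ s₁ ℚ.* 1/d ℚ.- fromℕ p₂ ℚ.+ fromℕ s₁
    in
    (N : ℕ) → HasSize (Cosets (ℤ/ n) G) N →
    (h : Bijection (Cosets (ℤ/ n) G) (CommutativeRing.setoid (ℤ/ N))) →
    IsZeroDifference (CommutativeRing.+-abelianGroup (ℤ/ n)) (CommutativeRing.+-abelianGroup (ℤ/ N))
      n (1 + t₁ + t₂ + d * t₁ * t₂)
      (fromℕ ⊢ (｛ a₀ ｝ ∪ ｛ a₁ ｝ ∪ ｛ a₂ ｝))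
      (cosetIndex (ℤ/ n) G h)
theorem3p10 p₁ p₂ pr₁ pr₂ p₁≢p₂ s₁ t₁ s₂ t₂ s₁t₁≡ s₂t₂≡ g₁ gen₁ g₂ gen₂ e e≡₁ e≡₂ N cosets h = record
  { domain-size     = mod-size (p₁ * p₂) {{nonZero-n}}
  -- Counting the codomain through the cosets avoids showing first that `N` is nonzero; `ℤ/ 0` would
  -- be infinite.
  ; codomain-finite = N , Composition.bijection cosets h
  ; image-size      = Representatives.image-size s₁ t₁ s₂ t₂ d split E₁ E₂
      (gcd[m,n]∣m s₁ s₂) (gcd[m,n]∣n s₁ s₂) α β αs₁+βs₂≡d f
      (C.cosetIndex⇒orbit h) (C.orbit⇒cosetIndex h)
  ; differences     = λ a a≉0 → difference a a≉0 (≈0? p₁ a) (≈0? p₂ a)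
  }
  where
  d = gcd s₁ s₂
  nonZero-n : NonZero (p₁ * p₂)
  nonZero-n = ℕ.m*n≢0 p₁ p₂ {{prime⇒nonZero pr₁}} {{prime⇒nonZero pr₂}}

  split : Split (p₁ * p₂) p₁ p₂
  split = split-* (distinct-primes⇒coprime pr₁ pr₂ p₁≢p₂)

  E+₁ : Σ (Exponential p₁ (s₁ * t₁)) λ E → ∀ k → Exponential.exp E (+ k) ≡ proj₁ g₁ ℤ.^ k [mod p₁ ]
  E+₁ = subst (λ m → Σ (Exponential p₁ m) λ E → ∀ k → Exponential.exp E (+ k) ≡ proj₁ g₁ ℤ.^ k [mod p₁ ])
    (sym s₁t₁≡) (exponential pr₁ g₁ gen₁)

  E+₂ : Σ (Exponential p₂ (s₂ * t₂)) λ E → ∀ k → Exponential.exp E (+ k) ≡ proj₁ g₂ ℤ.^ k [mod p₂ ]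
  E+₂ = subst (λ m → Σ (Exponential p₂ m) λ E → ∀ k → Exponential.exp E (+ k) ≡ proj₁ g₂ ℤ.^ k [mod p₂ ])
    (sym s₂t₂≡) (exponential pr₂ g₂ gen₂)

  E₁ = proj₁ E+₁
  E₂ = proj₁ E+₂
  α = proj₁ (bézout s₁ s₂)
  β = proj₁ (proj₂ (bézout s₁ s₂))
  αs₁+βs₂≡d = proj₂ (proj₂ (bézout s₁ s₂))

  ε = unitModProduct g₁ g₂ t₁ t₂ e e≡₁ e≡₂
  f = cosetIndex (ℤ/ (p₁ * p₂)) (⟨_⟩ (units (ℤ/ (p₁ * p₂))) ε) h

  module C = CyclicSubgroup s₁ t₁ s₂ t₂ split E₁ E₂ ε
    (≈-trans e≡₁ (≈-sym (≈-trans (Powers.pow-1 {s = s₁} {t₁} E₁) (proj₂ E+₁ t₁))))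
    (≈-trans e≡₂ (≈-sym (≈-trans (Powers.pow-1 {s = s₂} {t₂} E₂) (proj₂ E+₂ t₂))))

  1/d = + 1 ℚ./ d
  a₀ = 1/d ℚ.* (fromℕ s₁ ℚ.* fromℕ s₂ ℚ.- fromℕ s₁ ℚ.- fromℕ s₂) ℚ.+ 1ℚ
  a₁ = (fromℕ p₁ ℚ.- 1ℚ) ℚ.* fromℕ s₂ ℚ.* 1/d ℚ.- fromℕ p₁ ℚ.+ fromℕ s₂
  a₂ = (fromℕ p₂ ℚ.- 1ℚ) ℚ.* fromℕ s₁ ℚ.* 1/d ℚ.- fromℕ p₂ ℚ.+ fromℕ s₁

  v₁ v₂ : ℕ
  v₁ = ℕ∣.quotient (gcd[m,n]∣m s₁ s₂)
  v₂ = ℕ∣.quotient (gcd[m,n]∣n s₁ s₂)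
  s₁≡ : s₁ ≡ v₁ * d
  s₁≡ = _∣_.equality (gcd[m,n]∣m s₁ s₂)
  s₂≡ : s₂ ≡ v₂ * d
  s₂≡ = _∣_.equality (gcd[m,n]∣n s₁ s₂)

  nonZero-v₁ : NonZero v₁
  nonZero-v₁ = ℕ.m*n≢0⇒m≢0 v₁ {{subst (λ s → NonZero s) s₁≡ (ℕ.≢-nonZero (ℕ.≢-nonZero⁻¹ s₁))}}
  nonZero-v₂ : NonZero v₂
  nonZero-v₂ = ℕ.m*n≢0⇒m≢0 v₂ {{subst (λ s → NonZero s) s₂≡ (ℕ.≢-nonZero (ℕ.≢-nonZero⁻¹ s₂))}}

  F : ℤ → ℤ
  F = Func.to f

  shift≐ : ∀ a → Shift {s = s₁} {t₁} {s₂} {t₂} E₁ E₂ a ≐ (λ x → F (x ℤ.+ a) ≡ F x [mod N ])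
  shift≐ a = (λ {x} o → ≈-sym (C.orbit⇒cosetIndex h x (x ℤ.+ a) o)) ,
             (λ {x} e → C.cosetIndex⇒orbit h x (x ℤ.+ a) (≈-sym e))

  shift≐′ : ∀ a → Shift {s = s₂} {t₂} {s₁} {t₁} E₂ E₁ a ≐ (λ x → F (x ℤ.+ a) ≡ F x [mod N ])
  shift≐′ a = (λ {x} (k , e , e′) → proj₁ (shift≐ a) (k , e′ , e)) ,
              (λ {x} e → let (k , e , e′) = proj₂ (shift≐ a) {x} e in k , e′ , e)

  Difference : ℤ → Set
  Difference a = ∃ λ k →
    HasSize (subsetoid (CommutativeRing.setoid (ℤ/ (p₁ * p₂))) (λ x → F (x ℤ.+ a) ≡ F x [mod N ])) k
    × (fromℕ ⊢ (｛ a₀ ｝ ∪ ｛ a₁ ｝ ∪ ｛ a₂ ｝)) k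

  difference : ∀ a → ¬ (a ≡ 0ℤ [mod p₁ * p₂ ]) → Dec (a ≡ 0ℤ [mod p₁ ]) → Dec (a ≡ 0ℤ [mod p₂ ]) → Difference a
  difference a a≉0 (yes a≈0₁) (yes a≈0₂) = contradiction (Split.from split a≈0₁ a≈0₂) a≉0
  difference a a≉0 (no a≉0₁)  (no a≉0₂)  =
    let (k , size , k≡) = unit-shift-size d v₁ v₂ s₁ t₁ s₂ t₂ {{gcd-nonZero {s₁} {s₂}}} {{nonZero-v₁}} {{nonZero-v₂}}
          s₁≡ s₂≡ split E₁ E₂ α β αs₁+βs₂≡d a a≉0₁ a≉0₂
    in k , HasSize-≐ (shift≐ a) size , inj₁ (unit-value d s₁ s₂ k k≡)
  -- The primes exchange roles: `x` is now free modulo `p₁`, which contributes the factor `p₁ - 1`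
  -- of `a₁`.
  difference a a≉0 (yes a≈0₁) (no a≉0₂)  =
    let (k , size , k≡) = divisor-shift-size d v₂ v₁ s₂ t₂ s₁ t₁ {{gcd-nonZero {s₁} {s₂}}} {{nonZero-v₂}}
          s₂≡ s₁≡ (split-swap split) E₂ E₁ β α
          (trans (ℤ.+-comm (β ℤ.* + s₂) (α ℤ.* + s₁)) αs₁+βs₂≡d) a a≉0₂ a≈0₁
        p₁≡ = prime≡suc pr₁ s₁t₁≡
    in k , HasSize-≐ (shift≐′ a) size , inj₂ (inj₁ (divisor-value d p₁ (s₁ * t₁) s₂ k p₁≡
         (trans (cong (λ p → k * d + p * d) p₁≡) k≡)))
  difference a a≉0 (no a≉0₁)  (yes a≈0₂) =
    let (k , size , k≡) = divisor-shift-size d v₁ v₂ s₁ t₁ s₂ t₂ {{gcd-nonZero {s₁} {s₂}}} {{nonZero-v₁}}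
          s₁≡ s₂≡ split E₁ E₂ α β αs₁+βs₂≡d a a≉0₁ a≈0₂
        p₂≡ = prime≡suc pr₂ s₂t₂≡
    in k , HasSize-≐ (shift≐ a) size , inj₂ (inj₂ (divisor-value d p₂ (s₂ * t₂) s₁ k p₂≡
         (trans (cong (λ p → k * d + p * d) p₂≡) k≡)))
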